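{- There is an algorithm which, given a collection $\mathcal{A}=(\mathbf{a}_1,\ldots,\mathbf{a}_k)$ of $k\le 5$ integer sequences, each of length $\ell$, solves the Manhattan Sequence Consensus problem for $\mathcal{A}$ in $O(\ell)$ time, i.e. computes $\mathrm{OPT}(\mathcal{A})$ and a corresponding integer consensus sequence $\mathbf{x}$.
   Context: For integer sequences $\mathbf{x}=(x_1,\ldots,x_\ell)$ and $\mathbf{y}=(y_1,\ldots,y_\ell)$ the Manhattan distance is $\mathit{dist}(\mathbf{x},\mathbf{y})=\sum_{j=1}^{\ell}|x_j-y_j|$. The Manhattan Sequence Consensus (MSC) problem: the input is a collection $\mathcal{A}=(\mathbf{a}_1,\ldots,\mathbf{a}_k)$ of $k$ integer sequences $\mathbf{a}_i=(a_{i,1},\ldots,a_{i,\ell})$ of length $\ell$; the output is $\mathrm{OPT}(\mathcal{A})=\min_{\mathbf{x}}\max\{\mathit{dist}(\mathbf{x},\mathbf{a}_i):1\le i\le k\}$, where $\mathbf{x}$ ranges over all integer sequences of length $\ell$, together with an $\mathbf{x}$ attaining the minimum (a consensus sequence). Model of computation: $|a_{i,j}|\le M$, and $\ell,k,M$ fit in a machine word, so that arithmetic operations on integers of magnitude $O(\ell M)$ take constant time. -}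

module Defs where

open import Data.Bool using (if_then_else_)
open import Data.Fin using (toℕ; fromℕ<)
open import Data.Integer as ℤ using (ℤ; +_; ∣_∣; 0ℤ)
open import Data.Nat using (ℕ; _+_; _*_; _⊔_; _≤_; _<?_; _≡ᵇ_)
open import Data.Product using (_×_; ∃-syntax)
open import Data.Vec.Functional using (Vector; foldr; zipWith; map; concat)
open import Relation.Binary.PropositionalEquality using (_≡_)
open import Relation.Nullary using (¬_; yes; no)

Sequence : ℕ → Set
Sequence ℓ = Vector ℤ ℓ

Collection : ℕ → ℕ → Set
Collection k ℓ = Vector (Sequence ℓ) k

dist : ∀ {ℓ} → Sequence ℓ → Sequence ℓ → ℕ
dist x y = foldr _+_ 0 (zipWith (λ u v → ∣ u ℤ.- v ∣) x y)

-- max { dist(x, aᵢ) : 1 ≤ i ≤ k }; an empty maximum is 0, the least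
-- possible distance.
maxDist : ∀ {k ℓ} → Collection k ℓ → Sequence ℓ → ℕ
maxDist A x = foldr _⊔_ 0 (map (dist x) A)

-- v is the minimum of maxDist A over all integer sequences.
IsOPT : ∀ {k ℓ} → Collection k ℓ → ℕ → Set
IsOPT {ℓ = ℓ} A v =
  (∃[ x ] maxDist A x ≡ v) × ((x : Sequence ℓ) → v ≤ maxDist A x)

IsConsensus : ∀ {k ℓ} → Collection k ℓ → Sequence ℓ → Set
IsConsensus A x = IsOPT A (maxDist A x)

BoundedBy : ∀ {k ℓ} → ℕ → Collection k ℓ → Set
BoundedBy M A = ∀ i j → ∣ A i j ∣ ≤ M

-- The model of computation is a random access machine.  A program is a
-- finite piece of syntax, so it mentions finitely many registers and
-- literals, none of which can depend on the input.  Tests have the form ⊑,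
-- interpreted as ≤ on ℤ.

infixl 7 _⊗_ _⊘_
infixl 6 _⊕_ _⊖_
infix  4 _≔_ mem[_]≔_
infix  3 if_⊑_then_else_ while_⊑_loop_
infixr 2 _⨟_

data Expr : Set where
  lit             : ℤ → Expr
  reg[_]          : ℕ → Expr
  mem[_]          : Expr → Expr
  _⊕_ _⊖_ _⊗_ _⊘_ : Expr → Expr → Expr

data Program : Set where
  skip             : Program
  _≔_              : ℕ → Expr → Program
  mem[_]≔_         : Expr → Expr → Program
  _⨟_              : Program → Program → Program
  if_⊑_then_else_  : Expr → Expr → Program → Program → Program
  while_⊑_loop_    : Expr → Expr → Program → Program

-- The registers are separate from the addressable memory.
record State : Set where
  constructor ⟨_,_⟩
  field
    reg : ℕ → ℤ
    mem : ℕ → ℤ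

open State public

_[_↦_] : (ℕ → ℤ) → ℕ → ℤ → (ℕ → ℤ)
(f [ a ↦ v ]) b = if a ≡ᵇ b then v else f b

-- Each literal, register read, memory read and arithmetic operation takes
-- one unit of time.
cost : Expr → ℕ
cost (lit _)   = 1
cost reg[ _ ]  = 1
cost mem[ e ]  = 1 + cost e
cost (e₁ ⊕ e₂) = 1 + cost e₁ + cost e₂
cost (e₁ ⊖ e₂) = 1 + cost e₁ + cost e₂
cost (e₁ ⊗ e₂) = 1 + cost e₁ + cost e₂
cost (e₁ ⊘ e₂) = 1 + cost e₁ + cost e₂

-- A machine word holds the integers of magnitude at most W.  Evaluation has
-- no result on overflow, on division by zero, or on a negative address.
module _ (W : ℕ) where

  infix 1 _⊢_⇓_

  data _⊢_⇓_ (s : State) : Expr → ℤ → Set where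
    literal  : ∀ {v} → ∣ v ∣ ≤ W → s ⊢ lit v ⇓ v
    register : ∀ {r} → s ⊢ reg[ r ] ⇓ reg s r
    memory   : ∀ {e a} → s ⊢ e ⇓ + a → s ⊢ mem[ e ] ⇓ mem s a
    add : ∀ {e₁ e₂ u v} → s ⊢ e₁ ⇓ u → s ⊢ e₂ ⇓ v →
          ∣ u ℤ.+ v ∣ ≤ W → s ⊢ e₁ ⊕ e₂ ⇓ u ℤ.+ v
    sub : ∀ {e₁ e₂ u v} → s ⊢ e₁ ⇓ u → s ⊢ e₂ ⇓ v →
          ∣ u ℤ.- v ∣ ≤ W → s ⊢ e₁ ⊖ e₂ ⇓ u ℤ.- v
    mul : ∀ {e₁ e₂ u v} → s ⊢ e₁ ⇓ u → s ⊢ e₂ ⇓ v →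
          ∣ u ℤ.* v ∣ ≤ W → s ⊢ e₁ ⊗ e₂ ⇓ u ℤ.* v
    div : ∀ {e₁ e₂ u v} .{{_ : ℤ.NonZero v}} → s ⊢ e₁ ⇓ u → s ⊢ e₂ ⇓ v →
          ∣ u ℤ./ v ∣ ≤ W → s ⊢ e₁ ⊘ e₂ ⇓ u ℤ./ v

  -- Exec s P t s′: started in s, the program P halts in s′ after t units
  -- of time.  The semantics is deterministic, so a derivation describes the
  -- only run of P from s.
  data Exec (s : State) : Program → ℕ → State → Set where
    skip    : Exec s skip 1 s
    assign  : ∀ {r e v} → s ⊢ e ⇓ v →
              Exec s (r ≔ e) (1 + cost e) ⟨ reg s [ r ↦ v ] , mem s ⟩
    store   : ∀ {e₁ e₂ a v} → s ⊢ e₁ ⇓ + a → s ⊢ e₂ ⇓ v →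
              Exec s (mem[ e₁ ]≔ e₂) (1 + cost e₁ + cost e₂)
                ⟨ reg s , mem s [ a ↦ v ] ⟩
    seq     : ∀ {P Q t₁ t₂ s′ s″} → Exec s P t₁ s′ → Exec s′ Q t₂ s″ →
              Exec s (P ⨟ Q) (t₁ + t₂) s″
    if-yes  : ∀ {e₁ e₂ P Q u v t s′} → s ⊢ e₁ ⇓ u → s ⊢ e₂ ⇓ v →
              u ℤ.≤ v → Exec s P t s′ →
              Exec s (if e₁ ⊑ e₂ then P else Q) (1 + cost e₁ + cost e₂ + t) s′
    if-no   : ∀ {e₁ e₂ P Q u v t s′} → s ⊢ e₁ ⇓ u → s ⊢ e₂ ⇓ v →
              ¬ u ℤ.≤ v → Exec s Q t s′ →
              Exec s (if e₁ ⊑ e₂ then P else Q) (1 + cost e₁ + cost e₂ + t) s′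
    while-go   : ∀ {e₁ e₂ P u v t₁ t₂ s′ s″} → s ⊢ e₁ ⇓ u → s ⊢ e₂ ⇓ v →
                 u ℤ.≤ v → Exec s P t₁ s′ →
                 Exec s′ (while e₁ ⊑ e₂ loop P) t₂ s″ →
                 Exec s (while e₁ ⊑ e₂ loop P)
                   (1 + cost e₁ + cost e₂ + t₁ + t₂) s″
    while-stop : ∀ {e₁ e₂ P u v} → s ⊢ e₁ ⇓ u → s ⊢ e₂ ⇓ v →
                 ¬ u ℤ.≤ v →
                 Exec s (while e₁ ⊑ e₂ loop P) (1 + cost e₁ + cost e₂) s

cells : ∀ {n} → Vector ℤ n → ℕ → ℤ
cells {n} v a with a <? n
... | yes a<n = v (fromℕ< a<n)
... | no  _   = 0ℤ

-- Registers 0 and 1 hold k and ℓ, and the (0-indexed) entry A i j is at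
-- address i * ℓ + j; all other registers and cells are 0.
input : ∀ {k ℓ} → Collection k ℓ → State
input {k} {ℓ} A = ⟨ registers , cells (concat A) ⟩
  where
  registers : ℕ → ℤ
  registers 0 = + k
  registers 1 = + ℓ
  registers _ = 0ℤ

-- The value is returned in register 0 and the sequence in the first ℓ cells.
outputValue : State → ℤ
outputValue s = reg s 0

outputSequence : ∀ ℓ → State → Sequence ℓ
outputSequence ℓ s j = mem s (toℕ j)

-- In a column with entries a, moving x one step to the right changes the
-- distance to aᵢ by +1 if aᵢ ≤ x and by -1 otherwise, so the column splits into
-- at most 2ᵏ pieces labelled by the set S of entries to their left.  Only the
-- total amount n_S used from the pieces labelled S over all columns matters:
-- filling the pieces of a column in an order other than from left to right
-- never decreases the estimated distance below the true one.  The n_S solve an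
-- integer program with 2ᵏ unknowns and a fixed matrix, whose right-hand sides
-- are sums computed in one pass.  Cooper's quantifier elimination yields a fixed
-- finite list of terms (linear forms, divisions by constants) one of which is an
-- optimal solution whatever the right-hand sides are; the machine evaluates all
-- of them and keeps the best.  A second pass distributes the n_S greedily.
module Submission where

open import Defs
open import Data.Bool using (Bool; true; false; if_then_else_)
open import Data.Fin as Fin using (Fin; zero; suc; toℕ; fromℕ<; _↑ˡ_; _↑ʳ_)
import Data.Fin.Properties as Fin
open import Data.Integer as ℤ using (ℤ; +_; -[1+_]; 0ℤ; 1ℤ; -1ℤ; ∣_∣; +≤+; -≤+; +<+)
import Data.Integer.DivMod as ℤ
open import Data.Integer.Divisibility.Signed using (divides; _∣?_) renaming (_∣_ to _∣ℤ_)
import Data.Integer.Properties as ℤ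
open import Data.Integer.Tactic.RingSolver using (solve-∀)
open import Data.List as List using (List; []; _∷_; concatMap; upTo)
open import Data.List.Membership.Propositional.Properties using (∈-upTo⁺)
open import Data.List.Relation.Unary.All as All using (All; []; _∷_)
import Data.List.Relation.Unary.All.Properties as All
open import Data.List.Relation.Unary.Any as Any using (Any; here; there)
import Data.List.Relation.Unary.Any.Properties as Any
open import Data.Nat as ℕ using (ℕ; zero; suc; s≤s; z≤n; _+_; _*_; _≤_; _<_; _∸_; _≡ᵇ_)
import Data.Nat.Properties as ℕ
open import Data.Product using (_×_; _,_; proj₁; proj₂; ∃-syntax)
open import Data.Sum using (_⊎_; inj₁; inj₂)
open import Data.Unit using (⊤; tt)
open import Data.Vec as Vec using (Vec; []; _∷_; lookup)
open import Data.Vec.Functional using (foldr; concat)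
import Data.Vec.Properties as Vec
open import Data.Vec.Relation.Unary.All using ([]; _∷_) renaming (All to VAll)
import Data.Vec.Relation.Unary.All.Properties as VAll
open import Function using (_∘_; case_of_; id)
open import Relation.Binary.PropositionalEquality
open import Relation.Nullary using (¬_; Dec; yes; no; does; contradiction)
open import Relation.Nullary.Decidable using (dec-true; dec-false)

-- The program text may not depend on the input, so all that varies has to sit in the right-hand
-- sides. Hence `Lin` keeps integer coefficients, which alone decide the branching of Cooper's
-- procedure, apart from the constant parts, which stay symbolic terms; for each k the list returned
-- by `solve` is then closed syntax. It may be enormous, but nothing evaluates it: running time and
-- word size are read off the syntax by the recursive functions `time` and `magnitude`. The machine
-- never verifies a candidate. Each one is clamped into the box of feasible amounts, so a wrong
-- candidate still describes a legitimate sequence and at worst loses the comparison, while one that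
-- solves the system is left unchanged by the clamping. Optimality is a sandwich: every sequence
-- uses amounts whose objective is at most its largest distance (`sequence-lower`), and every
-- feasible choice of amounts is realised by a sequence whose largest distance is at most the
-- objective (`sequence-upper`).

private variable
  X Y : Set
  k n : ℕ

-- Terms and linear forms.

infixl 6 _∔_ _∸ᵗ_
infixr 7 _·_
infixl 7 _÷1+_

-- The operations that the machine has to perform. A divisor is always a positive literal, so a term
-- has a value in every environment.
data Tm (X : Set) : Set where
  var       : X → Tm X
  num       : ℤ → Tm X
  _∔_ _∸ᵗ_  : Tm X → Tm X → Tm X
  _·_       : ℤ → Tm X → Tm X
  _÷1+_     : Tm X → ℕ → Tm X
  if_≤_∶_∶_ : Tm X → Tm X → Tm X → Tm X → Tm X

⟦_⟧ : Tm X → (X → ℤ) → ℤ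
⟦ var x ⟧ ρ           = ρ x
⟦ num c ⟧ ρ           = c
⟦ s ∔ t ⟧ ρ           = ⟦ s ⟧ ρ ℤ.+ ⟦ t ⟧ ρ
⟦ s ∸ᵗ t ⟧ ρ          = ⟦ s ⟧ ρ ℤ.- ⟦ t ⟧ ρ
⟦ c · t ⟧ ρ           = c ℤ.* ⟦ t ⟧ ρ
⟦ t ÷1+ d ⟧ ρ         = ⟦ t ⟧ ρ ℤ./ + suc d
⟦ if s ≤ t ∶ u ∶ v ⟧ ρ = if does (⟦ s ⟧ ρ ℤ.≤? ⟦ t ⟧ ρ) then ⟦ u ⟧ ρ else ⟦ v ⟧ ρ

-- Linear forms in n variables whose constant part is a term in X.
data Lin (X : Set) : ℕ → Set where
  [_] : Tm X → Lin X 0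
  _∷_ : ℤ → Lin X n → Lin X (suc n)

ev : Lin X n → Vec ℤ n → (X → ℤ) → ℤ
ev [ t ]   []       ρ = ⟦ t ⟧ ρ
ev (c ∷ s) (x ∷ xs) ρ = c ℤ.* x ℤ.+ ev s xs ρ

comb : ℤ → Lin X n → ℤ → Lin X n → Lin X n
comb b [ s ]   c [ t ]    = [ b · s ∔ c · t ]
comb b (p ∷ s) c (q ∷ t) = (b ℤ.* p ℤ.+ c ℤ.* q) ∷ comb b s c t

term : Tm X → Lin X n
term {n = zero}  t = [ t ]
term {n = suc n} t = 0ℤ ∷ term t

unknown : Fin n → Lin X n
unknown zero    = 1ℤ ∷ term (num 0ℤ)
unknown (suc i) = 0ℤ ∷ unknown i

ev-comb : ∀ b (s : Lin X n) c t xs ρ →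
          ev (comb b s c t) xs ρ ≡ b ℤ.* ev s xs ρ ℤ.+ c ℤ.* ev t xs ρ
ev-comb b [ s ] c [ t ] [] ρ = refl
ev-comb b (p ∷ s) c (q ∷ t) (x ∷ xs) ρ
  rewrite ev-comb b s c t xs ρ = lemma b p c q x (ev s xs ρ) (ev t xs ρ)
  where
  lemma : ∀ b p c q x S T → (b ℤ.* p ℤ.+ c ℤ.* q) ℤ.* x ℤ.+ (b ℤ.* S ℤ.+ c ℤ.* T)
          ≡ b ℤ.* (p ℤ.* x ℤ.+ S) ℤ.+ c ℤ.* (q ℤ.* x ℤ.+ T)
  lemma = solve-∀

ev-term : ∀ (t : Tm X) (xs : Vec ℤ n) ρ → ev (term t) xs ρ ≡ ⟦ t ⟧ ρ
ev-term t []       ρ = refl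
ev-term t (x ∷ xs) ρ rewrite ev-term t xs ρ = ℤ.+-identityˡ (⟦ t ⟧ ρ)

ev-unknown : ∀ (i : Fin n) xs (ρ : X → ℤ) → ev (unknown i) xs ρ ≡ lookup xs i
ev-unknown zero    (x ∷ xs) ρ rewrite ev-term (num 0ℤ) xs ρ =
  trans (ℤ.+-identityʳ (1ℤ ℤ.* x)) (ℤ.*-identityˡ x)
ev-unknown (suc i) (x ∷ xs) ρ rewrite ev-unknown i xs ρ = ℤ.+-identityˡ (lookup xs i)

substitute : Lin X n → Vec (Tm X) n → Tm X
substitute [ t ]   []       = t
substitute (c ∷ s) (t ∷ ts) = c · t ∔ substitute s ts

⟦_⟧* : Vec (Tm X) n → (X → ℤ) → Vec ℤ n
⟦ ts ⟧* ρ = Vec.map (λ t → ⟦ t ⟧ ρ) ts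

⟦substitute⟧ : ∀ (s : Lin X n) ts ρ → ⟦ substitute s ts ⟧ ρ ≡ ev s (⟦ ts ⟧* ρ) ρ
⟦substitute⟧ [ t ]   []       ρ = refl
⟦substitute⟧ (c ∷ s) (t ∷ ts) ρ = cong (λ y → c ℤ.* ⟦ t ⟧ ρ ℤ.+ y) (⟦substitute⟧ s ts ρ)

-- Cooper's elimination

-- multiple d s asserts that 1 + d divides s.
data Constraint (X : Set) (n : ℕ) : Set where
  nonneg   : Lin X n → Constraint X n
  multiple : ℕ → Lin X n → Constraint X n

System : Set → ℕ → Set
System X n = List (Constraint X n)

Sat : Vec ℤ n → (X → ℤ) → Constraint X n → Set
Sat xs ρ (nonneg s)     = 0ℤ ℤ.≤ ev s xs ρ
Sat xs ρ (multiple d s) = + suc d ∣ℤ ev s xs ρ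

-- The product of the moduli takes the place of Cooper's least common multiple; any positive common
-- multiple will do.
period : System X n → ℕ
period []                   = 1
period (nonneg _ ∷ cs)     = period cs
period (multiple d _ ∷ cs) = suc d ℕ.* period cs

period-positive : ∀ (cs : System X n) → ∃[ p ] period cs ≡ suc p
period-positive []                   = 0 , refl
period-positive (nonneg _ ∷ cs)     = period-positive cs
period-positive (multiple d _ ∷ cs) with period cs | period-positive cs
... | _ | p , refl = p ℕ.+ d ℕ.* suc p , refl

-- The pivot (a , t) stands for the equation (1 + a) x = t.
Pivot : Set → ℕ → Set
Pivot X n = ℕ × Lin X n

-- If a lower bound (1 + a) x + s ≥ 0 is almost tight, its left side is some j below (1 + a) δ,
-- which gives (1 + a) x = j - s. The number of cases depends on the coefficient and δ, not on the
-- value of s.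
pivots : ℕ → Constraint X (suc n) → List (Pivot X n)
pivots δ (nonneg (+ suc a ∷ s)) =
  List.map (λ j → a , comb -1ℤ s 1ℤ (term (num (+ j)))) (upTo (suc a ℕ.* δ))
pivots δ _ = []

-- Multiplying b x + s by 1 + a and substituting t for (1 + a) x gives b t + (1 + a) s. A modulus 1
-- + d is scaled along; `d + a * suc d` is the predecessor of (1 + a)(1 + d).
resolve : Pivot X n → Constraint X (suc n) → Constraint X n
resolve (a , t) (nonneg (b ∷ s))     = nonneg (comb b t (+ suc a) s)
resolve (a , t) (multiple d (b ∷ s)) = multiple (d ℕ.+ a ℕ.* suc d) (comb b t (+ suc a) s)

residual : Pivot X n → System X (suc n) → System X n
residual (a , t) cs = multiple a t ∷ List.map (resolve (a , t)) cs

-- Makes x ≥ 0 a pivot candidate, so that the descent in x has to stop.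
bounded-below : System X (suc n) → System X (suc n)
bounded-below cs = nonneg (1ℤ ∷ term (num 0ℤ)) ∷ cs

-- One candidate for every sequence of pivot choices. Whether it is a solution depends on the values
-- of the constant terms, which are unknown here.
solve : ∀ n → System X n → List (Vec (Tm X) n)
solve zero    cs = [] ∷ []
solve (suc n) cs =
  concatMap (λ π → List.map (λ ts → substitute (proj₂ π) ts ÷1+ proj₁ π ∷ ts)
                            (solve n (residual π cs)))
            -- The added bound x ≥ 0 is a source of pivots and stays out of the residual, because
            -- the output has to satisfy `cs`.
            (concatMap (pivots (period cs)) (bounded-below cs))

module _ (a : ℕ) {x T : ℤ} (eq : + suc a ℤ.* x ≡ T) where

  resolve-identity : ∀ b S → b ℤ.* T ℤ.+ + suc a ℤ.* S ≡ + suc a ℤ.* (b ℤ.* x ℤ.+ S)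
  resolve-identity b S rewrite sym eq = lemma b x S (+ suc a)
    where
    lemma : ∀ b x S A → b ℤ.* (A ℤ.* x) ℤ.+ A ℤ.* S ≡ A ℤ.* (b ℤ.* x ℤ.+ S)
    lemma = solve-∀

module _ (ρ : X → ℤ) {xs : Vec ℤ n} {a : ℕ} {t : Lin X n} {x : ℤ}
         (eq : + suc a ℤ.* x ≡ ev t xs ρ) where

  ev-resolve : ∀ b s → ev (comb b t (+ suc a) s) xs ρ ≡ + suc a ℤ.* ev (b ∷ s) (x ∷ xs) ρ
  ev-resolve b s = trans (ev-comb b t (+ suc a) s xs ρ) (resolve-identity a eq b (ev s xs ρ))

  pos-* : ∀ d → + suc (d ℕ.+ a ℕ.* suc d) ≡ + suc a ℤ.* + suc d
  pos-* d = ℤ.pos-* (suc a) (suc d)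

  resolve-complete : ∀ c → Sat (x ∷ xs) ρ c → Sat xs ρ (resolve (a , t) c)
  resolve-complete (nonneg (b ∷ s)) 0≤ rewrite ev-resolve b s =
    subst (λ z → z ℤ.≤ + suc a ℤ.* ev (b ∷ s) (x ∷ xs) ρ) (ℤ.*-zeroʳ (+ suc a))
      (ℤ.*-monoˡ-≤-nonNeg (+ suc a) 0≤)
  resolve-complete (multiple d (b ∷ s)) (divides q e) rewrite ev-resolve b s | e =
    divides q (trans (lemma (+ suc a) q (+ suc d)) (cong (q ℤ.*_) (sym (pos-* d))))
    where
    lemma : ∀ A q D → A ℤ.* (q ℤ.* D) ≡ q ℤ.* (A ℤ.* D)
    lemma = solve-∀

  resolve-sound : ∀ c → Sat xs ρ (resolve (a , t) c) → Sat (x ∷ xs) ρ c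
  resolve-sound (nonneg (b ∷ s)) 0≤ rewrite ev-resolve b s =
    ℤ.*-cancelˡ-≤-pos 0ℤ _ (+ suc a)
      (subst (λ z → z ℤ.≤ + suc a ℤ.* ev (b ∷ s) (x ∷ xs) ρ) (sym (ℤ.*-zeroʳ (+ suc a))) 0≤)
  resolve-sound (multiple d (b ∷ s)) (divides q e) =
    divides q (ℤ.*-cancelˡ-≡ (+ suc a) _ _
      (trans (sym (ev-resolve b s)) (trans e (trans (cong (q ℤ.*_) (pos-* d))
        (lemma q (+ suc a) (+ suc d))))))
    where
    lemma : ∀ q A D → q ℤ.* (A ℤ.* D) ≡ A ℤ.* (q ℤ.* D)
    lemma = solve-∀

-- The remainder equals (1 + a) ∣ x - q ∣ and is less than 1 + a, so x = q.
exact-quotient : ∀ a {x T} → + suc a ℤ.* x ≡ T → T ℤ./ + suc a ≡ x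
exact-quotient a {x} {T} eq = sym (ℤ.i-j≡0⇒i≡j x q (ℤ.∣i∣≡0⇒i≡0 zero-difference))
  where
  q = T ℤ./ + suc a
  r = T ℤ.% + suc a
  rearrange : ∀ A x q r → A ℤ.* x ≡ r ℤ.+ q ℤ.* A → A ℤ.* (x ℤ.- q) ≡ r
  rearrange A x q r e = trans (l₁ A x q) (trans (cong (ℤ._- A ℤ.* q) e) (l₂ A q r))
    where
    l₁ : ∀ A x q → A ℤ.* (x ℤ.- q) ≡ A ℤ.* x ℤ.- A ℤ.* q
    l₁ = solve-∀
    l₂ : ∀ A q r → r ℤ.+ q ℤ.* A ℤ.- A ℤ.* q ≡ r
    l₂ = solve-∀
  remainder : suc a ℕ.* ∣ x ℤ.- q ∣ ≡ r
  remainder = trans (sym (ℤ.abs-* (+ suc a) (x ℤ.- q)))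
    (cong ∣_∣ (rearrange (+ suc a) x q (+ r) (trans eq (ℤ.a≡a%n+[a/n]*n T (+ suc a)))))
  zero-difference : ∣ x ℤ.- q ∣ ≡ 0
  zero-difference with ∣ x ℤ.- q ∣ | remainder
  ... | zero  | _ = refl
  ... | suc m | e = contradiction (ℤ.n%d<d T (+ suc a))
    (ℕ.≤⇒≯ (subst (suc a ℕ.≤_) e (ℕ.m≤m*n (suc a) (suc m))))

residual-complete : ∀ ρ {xs : Vec ℤ n} {π x} (cs : System X (suc n)) →
  + suc (proj₁ π) ℤ.* x ≡ ev (proj₂ π) xs ρ →
  All (Sat (x ∷ xs) ρ) cs → All (Sat xs ρ) (residual π cs)
residual-complete ρ {xs} {a , t} {x} cs eq sat =
  divides x (trans (sym eq) (ℤ.*-comm (+ suc a) x)) ∷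
  All.map⁺ (All.map (λ {c} → resolve-complete ρ {t = t} eq c) sat)

-- The head `multiple a t` of the residual makes the floor division exact; the factor 1 + a can then
-- be cancelled from each resolved constraint.
residual-sound : ∀ ρ {xs : Vec ℤ n} {π} (cs : System X (suc n)) →
  All (Sat xs ρ) (residual π cs) →
  All (Sat ((ev (proj₂ π) xs ρ ℤ./ + suc (proj₁ π)) ∷ xs) ρ) cs
residual-sound ρ {xs} {a , t} cs (divides q e ∷ sat) =
  subst (λ x → All (Sat (x ∷ xs) ρ) cs) (sym (exact-quotient a eq))
    (All.map (λ {c} → resolve-sound ρ {t = t} eq c) (All.map⁻ sat))
  where
  eq : + suc a ℤ.* q ≡ ev t xs ρ
  eq = trans (ℤ.*-comm (+ suc a) q) (sym e)

Sat? : ∀ (xs : Vec ℤ n) (ρ : X → ℤ) c → Dec (Sat xs ρ c)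
Sat? xs ρ (nonneg s)     = 0ℤ ℤ.≤? ev s xs ρ
Sat? xs ρ (multiple d s) = + suc d ∣? ev s xs ρ

Periodic : ℕ → Constraint X n → Set
Periodic δ (nonneg _)     = ⊤
Periodic δ (multiple d _) = + suc d ∣ℤ + δ

period-periodic : ∀ (cs : System X n) → All (Periodic (period cs)) cs
period-periodic []               = []
period-periodic (nonneg _ ∷ cs) = tt ∷ period-periodic cs
period-periodic (multiple d _ ∷ cs) =
  divides (+ period cs) (trans (cong +_ (ℕ.*-comm (suc d) (period cs))) (ℤ.pos-* (period cs) (suc d))) ∷
  All.map (λ {c} → extend c) (period-periodic cs)
  where
  extend : ∀ c → Periodic (period cs) c → Periodic (suc d ℕ.* period cs) c
  extend (nonneg _)     _             = tt
  extend (multiple e _) (divides q p) = divides (+ suc d ℤ.* q)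
    (trans (ℤ.pos-* (suc d) (period cs))
      (trans (cong (+ suc d ℤ.*_) p) (sym (ℤ.*-assoc (+ suc d) q (+ suc e)))))

-- A constraint that breaks when x decreases by δ must be a lower bound a x + s ≥ 0,
-- and then a x + s < a δ.
pivot-at : ∀ ρ (xs : Vec ℤ n) δ x c →
  Periodic δ c →
  Sat (x ∷ xs) ρ c → ¬ Sat ((x ℤ.- + δ) ∷ xs) ρ c →
  Any (λ π → + suc (proj₁ π) ℤ.* x ≡ ev (proj₂ π) xs ρ) (pivots {X} δ c)
-- The form changes by b δ, a multiple of 1 + d, so a divisibility cannot break.
pivot-at ρ xs δ x (multiple d (b ∷ s)) (divides p e′) (divides q e) violated =
  contradiction (divides (q ℤ.- b ℤ.* p) eq) violated
  where
  l₁ : ∀ b x δ S → b ℤ.* (x ℤ.- δ) ℤ.+ S ≡ (b ℤ.* x ℤ.+ S) ℤ.- b ℤ.* δ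
  l₁ = solve-∀
  l₂ : ∀ q D b p → q ℤ.* D ℤ.- b ℤ.* (p ℤ.* D) ≡ (q ℤ.- b ℤ.* p) ℤ.* D
  l₂ = solve-∀
  eq : b ℤ.* (x ℤ.- + δ) ℤ.+ ev s xs ρ ≡ (q ℤ.- b ℤ.* p) ℤ.* + suc d
  eq = trans (l₁ b x (+ δ) (ev s xs ρ))
    (trans (cong₂ (λ u v → u ℤ.- b ℤ.* v) e e′) (l₂ q (+ suc d) b p))
pivot-at ρ xs δ x (nonneg (b ∷ s)) _ 0≤ violated = go b 0≤ (ℤ.≰⇒> violated)
  where
  S = ev s xs ρ
  l₁ : ∀ b x δ S → b ℤ.* (x ℤ.- δ) ℤ.+ S ≡ (b ℤ.* x ℤ.+ S) ℤ.- b ℤ.* δ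
  l₁ = solve-∀
  l₂ : ∀ b x δ S → b ℤ.* (x ℤ.- δ) ℤ.+ S ≡ (b ℤ.* x ℤ.+ S) ℤ.+ ℤ.- b ℤ.* δ
  l₂ = solve-∀
  l₃ : ∀ b x S → b ℤ.* x ≡ -1ℤ ℤ.* S ℤ.+ 1ℤ ℤ.* (b ℤ.* x ℤ.+ S)
  l₃ = solve-∀
  l₄ : ∀ u v → u ℤ.- v ℤ.+ v ≡ u
  l₄ = solve-∀
  go : ∀ b → 0ℤ ℤ.≤ b ℤ.* x ℤ.+ S → b ℤ.* (x ℤ.- + δ) ℤ.+ S ℤ.< 0ℤ →
       Any (λ π → + suc (proj₁ π) ℤ.* x ≡ ev (proj₂ π) xs ρ) (pivots δ (nonneg (b ∷ s)))
  go (+ suc a) 0≤ <0 with + suc a ℤ.* x ℤ.+ S in e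
  go (+ suc a) (+≤+ _) <0 | + j = Any.map⁺ (Any.map (λ { refl → eq }) (∈-upTo⁺ j<))
    where
    eq : + suc a ℤ.* x ≡ ev (comb -1ℤ s 1ℤ (term (num (+ j)))) xs ρ
    eq = trans (l₃ (+ suc a) x S) (trans (cong (λ y → -1ℤ ℤ.* S ℤ.+ 1ℤ ℤ.* y)
      (trans e (sym (ev-term (num (+ j)) xs ρ)))) (sym (ev-comb -1ℤ s 1ℤ (term (num (+ j))) xs ρ)))
    j< : j ℕ.< suc a ℕ.* δ
    j< = ℤ.drop‿+<+ (subst₂ ℤ._<_ (l₄ (+ j) (+ suc a ℤ.* + δ))
      (trans (ℤ.+-identityˡ _) (sym (ℤ.pos-* (suc a) δ)))
      (ℤ.+-monoˡ-< (+ suc a ℤ.* + δ)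
        (subst (ℤ._< 0ℤ) (trans (l₁ (+ suc a) x (+ δ) S) (cong (ℤ._- + suc a ℤ.* + δ) e)) <0)))
  -- When x decreases, a form with coefficient zero is constant and one with negative coefficient
  -- does not decrease, so neither can become negative.
  go (+ zero) 0≤ <0 = contradiction (ℤ.≤-<-trans 0≤ <0) (ℤ.<-irrefl refl)
  go -[1+ a ] 0≤ <0 = contradiction (ℤ.≤-<-trans 0≤ (ℤ.≤-<-trans increasing <0)) (ℤ.<-irrefl refl)
    where
    U = -[1+ a ] ℤ.* x ℤ.+ S
    increasing : U ℤ.≤ -[1+ a ] ℤ.* (x ℤ.- + δ) ℤ.+ S
    increasing = subst (U ℤ.≤_)
      (trans (cong (λ y → U ℤ.+ y) (ℤ.pos-* (suc a) δ)) (sym (l₂ -[1+ a ] x (+ δ) S)))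
      (ℤ.i≤i+j U (+ (suc a ℕ.* δ)))

module _ (ρ : X → ℤ) (xs : Vec ℤ n) (cs : System X (suc n)) where

  cs⁺ = bounded-below cs
  δ   = period cs

  Pivoted : ℤ → Pivot X n → Set
  Pivoted x π = + suc (proj₁ π) ℤ.* x ≡ ev (proj₂ π) xs ρ

  find-pivot : ∀ x ds → All (Periodic δ) ds →
    All (Sat (x ∷ xs) ρ) ds →
    All (Sat ((x ℤ.- + δ) ∷ xs) ρ) ds ⊎ Any (Pivoted x) (concatMap (pivots δ) ds)
  find-pivot x [] [] [] = inj₁ []
  find-pivot x (c ∷ ds) (p ∷ ps) (s ∷ ss) with Sat? ((x ℤ.- + δ) ∷ xs) ρ c
  ... | no ¬s = inj₂ (Any.++⁺ˡ (pivot-at ρ xs δ x c p s ¬s))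
  ... | yes s′ with find-pivot x ds ps ss
  ...   | inj₁ ss′ = inj₁ (s′ ∷ ss′)
  ...   | inj₂ any = inj₂ (Any.++⁺ʳ (pivots δ c) any)

  -- Cooper's descent in steps of δ ≥ 1, by induction on the strict upper bound m of x. The conjunct
  -- y ≤ x is what later makes the last unknown small.
  descend : ∀ m x → x ℤ.< + m → All (Sat (x ∷ xs) ρ) cs⁺ →
    ∃[ y ] y ℤ.≤ x × All (Sat (y ∷ xs) ρ) cs⁺ × Any (Pivoted y) (concatMap (pivots δ) cs⁺)
  descend zero x x<0 (0≤x ∷ _) =
    contradiction (ℤ.≤-<-trans (subst (0ℤ ℤ.≤_) (ev-unknown zero (x ∷ xs) ρ) 0≤x) x<0) (ℤ.<-irrefl refl)
  descend (suc m) x x<m sat with find-pivot x cs⁺ (tt ∷ period-periodic cs) sat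
  ... | inj₂ any = x , ℤ.≤-refl , sat , any
  ... | inj₁ sat′ with descend m (x ℤ.- + δ) smaller sat′
    where
    smaller : x ℤ.- + δ ℤ.< + m
    smaller with period cs | period-positive cs
    ... | _ | p , refl = ℤ.≤-<-trans (ℤ.+-monoʳ-≤ x (ℤ.neg-mono-≤ {+ 1} (+≤+ (s≤s z≤n))))
                           (subst (x ℤ.- + 1 ℤ.<_) refl (ℤ.+-monoˡ-< -1ℤ x<m))
  ...   | y , y≤ , rest = y , ℤ.≤-trans y≤ (ℤ.i-j≤i x (+ δ)) , rest

  eliminate : ∀ {x} → 0ℤ ℤ.≤ x → All (Sat (x ∷ xs) ρ) cs →
    ∃[ y ] y ℤ.≤ x × All (Sat (y ∷ xs) ρ) cs × Any (Pivoted y) (concatMap (pivots δ) cs⁺)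
  eliminate {x} 0≤x sat
    with descend (suc ∣ x ∣) x (ℤ.≤-<-trans (ℤ.≤-reflexive (sym (ℤ.0≤i⇒+∣i∣≡i 0≤x))) (+<+ (ℕ.n<1+n _)))
           (subst (0ℤ ℤ.≤_) (sym (ev-unknown zero (x ∷ xs) ρ)) 0≤x ∷ sat)
  ... | y , y≤ , (_ ∷ sat′) , any = y , y≤ , sat′ , any

Solution : ∀ {n} → (X → ℤ) → System X n → Vec (Tm X) n → Set
Solution ρ cs ts = All (Sat (⟦ ts ⟧* ρ) ρ) cs

extend-solution : ∀ ρ (cs : System X (suc n)) π ts →
  Solution ρ (residual π cs) ts → Solution ρ cs (substitute (proj₂ π) ts ÷1+ proj₁ π ∷ ts)
extend-solution ρ cs π ts sol = subst
  (λ T → All (Sat ((T ℤ./ + suc (proj₁ π)) ∷ ⟦ ts ⟧* ρ) ρ) cs)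
  (sym (⟦substitute⟧ (proj₂ π) ts ρ))
  (residual-sound ρ {π = π} cs sol)

-- The last unknown is eliminated last, when all other unknowns are gone, so the
-- solution found has the least possible value there.
solve-complete : ∀ ρ (cs : System X (n ℕ.+ 1)) xs → VAll (0ℤ ℤ.≤_) xs → All (Sat xs ρ) cs →
  Any (λ ts → Solution ρ cs ts × lookup (⟦ ts ⟧* ρ) (n ↑ʳ zero) ℤ.≤ lookup xs (n ↑ʳ zero))
      (solve (n ℕ.+ 1) cs)
solve-complete {n = zero} ρ cs (x ∷ []) (0≤x ∷ []) sat with eliminate ρ [] cs 0≤x sat
... | y , y≤x , sat′ , any = Any.concatMap⁺ _ (Any.map
  (λ {π} eq → here (extend-solution ρ cs π [] (residual-complete ρ {π = π} cs eq sat′)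
    , subst (ℤ._≤ x) (sym (trans (cong (ℤ._/ + suc (proj₁ π)) (⟦substitute⟧ (proj₂ π) [] ρ))
                                 (exact-quotient (proj₁ π) eq))) y≤x)) any)
-- Eliminating x moves x alone and keeps `xs`, so the comparison for the last unknown passes through
-- unchanged.
solve-complete {n = suc n} ρ cs (x ∷ xs) (0≤x ∷ 0≤xs) sat with eliminate ρ xs cs 0≤x sat
... | y , _ , sat′ , any = Any.concatMap⁺ _ (Any.map
  (λ {π} eq → Any.map⁺ (Any.map (λ { {ts} (sol , z≤) → extend-solution ρ cs π ts sol , z≤ })
    (solve-complete ρ (residual π cs) xs 0≤xs (residual-complete ρ {π = π} cs eq sat′)))) any)

-- The set of those i whose entry is true.
Type : ℕ → Set
Type k = Vec Bool k

-- Sums and signed sums over all types.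

record Additive (X : Set) : Set where
  field _⊞_ _⊟_ : X → X → X
open Additive

total : Additive X → (Type k → X) → X
total {k = zero}  𝒜 f = f []
total {k = suc k} 𝒜 f = 𝒜 ._⊞_ (total 𝒜 (f ∘ (false ∷_))) (total 𝒜 (f ∘ (true ∷_)))

-- The sum over the S containing i minus the sum over the other S, that is, the change of the
-- distance to the i-th entry when f S is moved through pieces of type S.
balance : Additive X → Fin k → (Type k → X) → X
balance 𝒜 zero    f = 𝒜 ._⊟_ (total 𝒜 (f ∘ (true ∷_))) (total 𝒜 (f ∘ (false ∷_)))
balance 𝒜 (suc i) f = 𝒜 ._⊞_ (balance 𝒜 i (f ∘ (false ∷_))) (balance 𝒜 i (f ∘ (true ∷_)))

module _ (𝒜 : Additive X) (ℬ : Additive Y) (h : X → Y)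
         (h-⊞ : ∀ x y → h (𝒜 ._⊞_ x y) ≡ ℬ ._⊞_ (h x) (h y))
         (h-⊟ : ∀ x y → h (𝒜 ._⊟_ x y) ≡ ℬ ._⊟_ (h x) (h y)) where

  -- `Additive` carries no laws: the same recursion is read in integers, sequences, terms and linear
  -- forms, and these two lemmas carry results from one reading to another.
  total-hom : (f : Type k → X) (g : Type k → Y) → (∀ S → h (f S) ≡ g S) →
              h (total 𝒜 f) ≡ total ℬ g
  total-hom {k = zero}  f g f≗g = f≗g []
  total-hom {k = suc k} f g f≗g = trans (h-⊞ _ _)
    (cong₂ (ℬ ._⊞_) (total-hom _ _ (f≗g ∘ (false ∷_))) (total-hom _ _ (f≗g ∘ (true ∷_))))

  balance-hom : ∀ i (f : Type k → X) (g : Type k → Y) → (∀ S → h (f S) ≡ g S) →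
                h (balance 𝒜 i f) ≡ balance ℬ i g
  balance-hom zero f g f≗g = trans (h-⊟ _ _)
    (cong₂ (ℬ ._⊟_) (total-hom _ _ (f≗g ∘ (true ∷_))) (total-hom _ _ (f≗g ∘ (false ∷_))))
  balance-hom (suc i) f g f≗g = trans (h-⊞ _ _)
    (cong₂ (ℬ ._⊞_) (balance-hom i _ _ (f≗g ∘ (false ∷_))) (balance-hom i _ _ (f≗g ∘ (true ∷_))))

integers : Additive ℤ
integers = record { _⊞_ = ℤ._+_ ; _⊟_ = ℤ._-_ }

totalℤ : (Type k → ℤ) → ℤ
totalℤ = total integers

balanceℤ : Fin k → (Type k → ℤ) → ℤ
balanceℤ = balance integers

balanceℤ-cong : ∀ i {f g : Type k → ℤ} → (∀ S → f S ≡ g S) → balanceℤ i f ≡ balanceℤ i g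
balanceℤ-cong i = balance-hom integers integers id (λ _ _ → refl) (λ _ _ → refl) i _ _

totalℤ-cong : ∀ {f g : Type k → ℤ} → (∀ S → f S ≡ g S) → totalℤ f ≡ totalℤ g
totalℤ-cong = total-hom integers integers id (λ _ _ → refl) (λ _ _ → refl) _ _

-- The sum over the S that do not contain i, i.e. over the pieces to the left of the i-th entry.
without : Fin k → (Type k → ℤ) → ℤ
without zero    f = totalℤ (f ∘ (false ∷_))
without (suc i) f = without i (f ∘ (false ∷_)) ℤ.+ without i (f ∘ (true ∷_))

balance-without : ∀ i (f : Type k → ℤ) →
                  balanceℤ i f ≡ totalℤ f ℤ.- (without i f ℤ.+ without i f)
balance-without zero f = lemma (totalℤ (f ∘ (true ∷_))) (totalℤ (f ∘ (false ∷_)))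
  where
  lemma : ∀ u v → u ℤ.- v ≡ (v ℤ.+ u) ℤ.- (v ℤ.+ v)
  lemma = solve-∀
balance-without (suc i) f =
  trans (cong₂ ℤ._+_ (balance-without i _) (balance-without i _))
    (lemma (totalℤ (f ∘ (false ∷_))) (without i (f ∘ (false ∷_)))
           (totalℤ (f ∘ (true ∷_))) (without i (f ∘ (true ∷_))))
  where
  lemma : ∀ t w t′ w′ → (t ℤ.- (w ℤ.+ w)) ℤ.+ (t′ ℤ.- (w′ ℤ.+ w′)) ≡
          (t ℤ.+ t′) ℤ.- ((w ℤ.+ w′) ℤ.+ (w ℤ.+ w′))
  lemma = solve-∀

total-mono : {f g : Type k → ℤ} → (∀ S → f S ℤ.≤ g S) → totalℤ f ℤ.≤ totalℤ g
total-mono {k = zero}  f≤g = f≤g []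
total-mono {k = suc k} f≤g =
  ℤ.+-mono-≤ (total-mono (f≤g ∘ (false ∷_))) (total-mono (f≤g ∘ (true ∷_)))

without-mono : ∀ i {f g : Type k → ℤ} → (∀ S → f S ℤ.≤ g S) → without i f ℤ.≤ without i g
without-mono zero    f≤g = total-mono (f≤g ∘ (false ∷_))
without-mono (suc i) f≤g =
  ℤ.+-mono-≤ (without-mono i (f≤g ∘ (false ∷_))) (without-mono i (f≤g ∘ (true ∷_)))

total-nonneg : {f : Type k → ℤ} → (∀ S → 0ℤ ℤ.≤ f S) → 0ℤ ℤ.≤ totalℤ f
total-nonneg {k = zero}  0≤f = 0≤f []
total-nonneg {k = suc k} 0≤f =
  ℤ.+-mono-≤ (total-nonneg (0≤f ∘ (false ∷_))) (total-nonneg (0≤f ∘ (true ∷_)))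

without≤total : ∀ i {f : Type k → ℤ} → (∀ S → 0ℤ ℤ.≤ f S) → without i f ℤ.≤ totalℤ f
without≤total zero {f} 0≤f = subst (ℤ._≤ totalℤ f) (ℤ.+-identityʳ _)
  (ℤ.+-monoʳ-≤ (totalℤ (f ∘ (false ∷_))) (total-nonneg (0≤f ∘ (true ∷_))))
without≤total (suc i) 0≤f =
  ℤ.+-mono-≤ (without≤total i (0≤f ∘ (false ∷_))) (without≤total i (0≤f ∘ (true ∷_)))

-- Decomposition of a column

clamp : ℤ → ℤ → ℤ → ℤ
clamp lo hi x = lo ℤ.⊔ (hi ℤ.⊓ x)

lo≤clamp : ∀ lo hi x → lo ℤ.≤ clamp lo hi x
lo≤clamp lo hi x = ℤ.i≤i⊔j lo _

clamp≤hi : ∀ {lo hi} x → lo ℤ.≤ hi → clamp lo hi x ℤ.≤ hi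
clamp≤hi {hi = hi} x lo≤hi = ℤ.⊔-lub lo≤hi (ℤ.i⊓j≤i hi x)

clamp-inside : ∀ {lo hi x} → lo ℤ.≤ x → x ℤ.≤ hi → clamp lo hi x ≡ x
clamp-inside lo≤x x≤hi rewrite ℤ.i≥j⇒i⊓j≡j x≤hi = ℤ.i≤j⇒i⊔j≡j lo≤x

clamp-⊓ : ∀ lo hi a x → clamp lo (clamp lo hi a) x ≡ clamp lo hi (x ℤ.⊓ a)
clamp-⊓ lo hi a x = begin
  lo ℤ.⊔ ((lo ℤ.⊔ (hi ℤ.⊓ a)) ℤ.⊓ x)         ≡⟨ cong (lo ℤ.⊔_) (ℤ.⊓-distribʳ-⊔ x lo (hi ℤ.⊓ a)) ⟩
  lo ℤ.⊔ ((lo ℤ.⊓ x) ℤ.⊔ (hi ℤ.⊓ a ℤ.⊓ x))   ≡⟨ ℤ.⊔-assoc lo _ _ ⟨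
  lo ℤ.⊔ (lo ℤ.⊓ x) ℤ.⊔ (hi ℤ.⊓ a ℤ.⊓ x)     ≡⟨ cong₂ ℤ._⊔_ (ℤ.⊔-absorbs-⊓ lo x)
                                                  (trans (ℤ.⊓-assoc hi a x) (cong (hi ℤ.⊓_) (ℤ.⊓-comm a x))) ⟩
  lo ℤ.⊔ (hi ℤ.⊓ (x ℤ.⊓ a))                   ∎
  where open ≡-Reasoning

-- Both sides measure the part of [lo , hi] to the left of y. Cutting at p is the step that lets the
-- two branches of `piece` be added up.
clamp-split : ∀ {lo p hi} y → lo ℤ.≤ p → p ℤ.≤ hi →
  (clamp lo p y ℤ.- lo) ℤ.+ (clamp p hi y ℤ.- p) ≡ clamp lo hi y ℤ.- lo
clamp-split {lo} {p} {hi} y lo≤p p≤hi with ℤ.≤-total y p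
... | inj₁ y≤p
  rewrite ℤ.i≥j⇒i⊓j≡j y≤p | ℤ.i≥j⇒i⊓j≡j (ℤ.≤-trans y≤p p≤hi) | ℤ.i≥j⇒i⊔j≡i y≤p = lemma (lo ℤ.⊔ y) lo p
  where
  lemma : ∀ u lo p → (u ℤ.- lo) ℤ.+ (p ℤ.- p) ≡ u ℤ.- lo
  lemma = solve-∀
... | inj₂ p≤y
  rewrite ℤ.i≤j⇒i⊓j≡i p≤y | ℤ.i≤j⇒i⊔j≡j lo≤p | ℤ.i≤j⇒i⊔j≡j (ℤ.⊓-glb p≤hi p≤y)
        | ℤ.i≤j⇒i⊔j≡j (ℤ.≤-trans lo≤p (ℤ.⊓-glb p≤hi p≤y)) = lemma (hi ℤ.⊓ y) lo p
  where
  lemma : ∀ u lo p → (p ℤ.- lo) ℤ.+ (u ℤ.- p) ≡ u ℤ.- lo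
  lemma = solve-∀

-- The entries a of a column cut [lo , hi] into pieces; the piece of type S
-- lies to the right of exactly the entries in S.  This is the length of its
-- part to the left of x.
piece : ℤ → ℤ → (Fin k → ℤ) → ℤ → Type k → ℤ
piece lo hi a x []          = clamp lo hi x ℤ.- lo
piece lo hi a x (false ∷ S) = piece lo (clamp lo hi (a zero)) (a ∘ suc) x S
piece lo hi a x (true ∷ S)  = piece (clamp lo hi (a zero)) hi (a ∘ suc) x S

piece-nonneg : ∀ {lo hi} (a : Fin k → ℤ) x → lo ℤ.≤ hi → ∀ S → 0ℤ ℤ.≤ piece lo hi a x S
piece-nonneg {lo = lo} {hi} a x lo≤hi [] = ℤ.i≤j⇒0≤j-i (lo≤clamp lo hi x)
piece-nonneg a x lo≤hi (false ∷ S) = piece-nonneg (a ∘ suc) x (lo≤clamp _ _ _) S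
piece-nonneg a x lo≤hi (true ∷ S)  = piece-nonneg (a ∘ suc) x (clamp≤hi _ lo≤hi) S

piece≤full : ∀ {lo hi top} (a : Fin k → ℤ) x → lo ℤ.≤ hi → hi ℤ.≤ top →
             ∀ S → piece lo hi a x S ℤ.≤ piece lo hi a top S
piece≤full {lo = lo} {hi} {top} a x lo≤hi hi≤top []
  rewrite ℤ.i≤j⇒i⊓j≡i hi≤top | ℤ.i≤j⇒i⊔j≡j lo≤hi = ℤ.+-monoˡ-≤ (ℤ.- lo) (clamp≤hi x lo≤hi)
piece≤full a x lo≤hi hi≤top (false ∷ S) =
  piece≤full (a ∘ suc) x (lo≤clamp _ _ _) (ℤ.≤-trans (clamp≤hi (a zero) lo≤hi) hi≤top) S
piece≤full a x lo≤hi hi≤top (true ∷ S) =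
  piece≤full (a ∘ suc) x (clamp≤hi _ lo≤hi) hi≤top S

piece≤ : ∀ {lo hi} (a : Fin k → ℤ) x → lo ℤ.≤ hi → ∀ S → piece lo hi a x S ℤ.≤ hi ℤ.- lo
piece≤ {lo = lo} a x lo≤hi [] = ℤ.+-monoˡ-≤ (ℤ.- lo) (clamp≤hi x lo≤hi)
piece≤ {lo = lo} a x lo≤hi (false ∷ S) = ℤ.≤-trans (piece≤ (a ∘ suc) x (lo≤clamp _ _ _) S)
  (ℤ.+-monoˡ-≤ (ℤ.- lo) (clamp≤hi (a zero) lo≤hi))
piece≤ {lo = lo} {hi} a x lo≤hi (true ∷ S) = ℤ.≤-trans (piece≤ (a ∘ suc) x (clamp≤hi _ lo≤hi) S)
  (ℤ.+-monoʳ-≤ hi (ℤ.neg-mono-≤ (lo≤clamp lo hi (a zero))))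

total-piece : ∀ {lo hi} (a : Fin k → ℤ) x → lo ℤ.≤ hi →
              totalℤ (piece lo hi a x) ≡ clamp lo hi x ℤ.- lo
total-piece {k = zero}  a x lo≤hi = refl
total-piece {k = suc k} a x lo≤hi = trans
  (cong₂ ℤ._+_ (total-piece (a ∘ suc) x (lo≤clamp _ _ _)) (total-piece (a ∘ suc) x (clamp≤hi _ lo≤hi)))
  (clamp-split x (lo≤clamp _ _ _) (clamp≤hi _ lo≤hi))

-- The pieces to the left of a i make up the interval from lo to the clamped a i, so their parts
-- left of x end at the smaller of x and a i. `clamp-⊓` supplies this where i is the current cut,
-- `clamp-split` adds the halves otherwise.
without-piece : ∀ {lo hi} (a : Fin k → ℤ) x i → lo ℤ.≤ hi →
                without i (piece lo hi a x) ≡ clamp lo hi (x ℤ.⊓ a i) ℤ.- lo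
without-piece {lo = lo} {hi} a x zero lo≤hi = trans
  (total-piece (a ∘ suc) x (lo≤clamp _ _ _)) (cong (ℤ._- lo) (clamp-⊓ lo hi (a zero) x))
without-piece a x (suc i) lo≤hi = trans
  (cong₂ ℤ._+_ (without-piece (a ∘ suc) x i (lo≤clamp _ _ _))
               (without-piece (a ∘ suc) x i (clamp≤hi _ lo≤hi)))
  (clamp-split (x ℤ.⊓ a (suc i)) (lo≤clamp _ _ _) (clamp≤hi _ lo≤hi))

-- Reduces an inequality to a ring identity with an explicit nonnegative slack d.
≤-by : ∀ {x y} d → 0ℤ ℤ.≤ d → y ≡ x ℤ.+ d → x ℤ.≤ y
≤-by {x} d 0≤d refl = subst (ℤ._≤ x ℤ.+ d) (ℤ.+-identityʳ x) (ℤ.+-monoʳ-≤ x 0≤d)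

double-nonneg : ∀ {x} → 0ℤ ℤ.≤ x → 0ℤ ℤ.≤ x ℤ.+ x
double-nonneg 0≤x = ℤ.+-mono-≤ 0≤x 0≤x

∣∣-lub : ∀ {x y} → x ℤ.≤ y → ℤ.- x ℤ.≤ y → + ∣ x ∣ ℤ.≤ y
∣∣-lub {+ _}      x≤y _    = x≤y
∣∣-lub { -[1+ _ ]} _   -x≤y = -x≤y

x≤∣x∣ : ∀ x → x ℤ.≤ + ∣ x ∣
x≤∣x∣ (+ _)    = ℤ.≤-refl
x≤∣x∣ -[1+ _ ] = -≤+

-x≤∣x∣ : ∀ x → ℤ.- x ℤ.≤ + ∣ x ∣
-x≤∣x∣ x = subst (λ y → ℤ.- x ℤ.≤ + y) (ℤ.∣-i∣≡∣i∣ x) (x≤∣x∣ (ℤ.- x))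

module _ {lo hi : ℤ} {a : Fin k → ℤ} (i : Fin k) (lo≤a : lo ℤ.≤ a i) (a≤hi : a i ℤ.≤ hi) where

  private lo≤hi = ℤ.≤-trans lo≤a a≤hi

  balance-piece : ∀ x → (a i ℤ.- lo) ℤ.+ balanceℤ i (piece lo hi a x) ≡
    (a i ℤ.- lo) ℤ.+ ((clamp lo hi x ℤ.- lo) ℤ.-
      ((clamp lo hi (x ℤ.⊓ a i) ℤ.- lo) ℤ.+ (clamp lo hi (x ℤ.⊓ a i) ℤ.- lo)))
  balance-piece x rewrite balance-without i (piece lo hi a x)
    | total-piece a x lo≤hi | without-piece a x i lo≤hi = refl

  -- The left side is the distance from a i to x clamped into [lo , hi]. The slack in each case is
  -- the distance from x to that interval.
  column-lower : ∀ x → (a i ℤ.- lo) ℤ.+ balanceℤ i (piece lo hi a x) ℤ.≤ + ∣ x ℤ.- a i ∣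
  column-lower x rewrite balance-piece x with ℤ.≤-total x (a i)
  ... | inj₁ x≤a rewrite ℤ.i≤j⇒i⊓j≡i x≤a | ℤ.i≥j⇒i⊓j≡j (ℤ.≤-trans x≤a a≤hi) = ℤ.≤-trans
    (≤-by (lo ℤ.⊔ x ℤ.- x) (ℤ.i≤j⇒0≤j-i (ℤ.i≤j⊔i lo x)) (lemma (a i) x lo (lo ℤ.⊔ x)))
    (-x≤∣x∣ (x ℤ.- a i))
    where
    lemma : ∀ a x lo u → ℤ.- (x ℤ.- a) ≡
      (a ℤ.- lo) ℤ.+ ((u ℤ.- lo) ℤ.- ((u ℤ.- lo) ℤ.+ (u ℤ.- lo))) ℤ.+ (u ℤ.- x)
    lemma = solve-∀
  ... | inj₂ a≤x rewrite ℤ.i≥j⇒i⊓j≡j a≤x | clamp-inside lo≤a a≤hi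
    | ℤ.i≤j⇒i⊔j≡j (ℤ.⊓-glb lo≤hi (ℤ.≤-trans lo≤a a≤x)) = ℤ.≤-trans
    (≤-by (x ℤ.- hi ℤ.⊓ x) (ℤ.i≤j⇒0≤j-i (ℤ.i⊓j≤j hi x)) (lemma (a i) x lo (hi ℤ.⊓ x)))
    (x≤∣x∣ (x ℤ.- a i))
    where
    lemma : ∀ a x lo u → x ℤ.- a ≡
      (a ℤ.- lo) ℤ.+ ((u ℤ.- lo) ℤ.- ((a ℤ.- lo) ℤ.+ (a ℤ.- lo))) ℤ.+ (x ℤ.- u)
    lemma = solve-∀

  -- An arbitrary filling of the pieces is no better than filling them from left to right.
  column-upper : ∀ m → (∀ S → 0ℤ ℤ.≤ m S) → (∀ S → m S ℤ.≤ piece lo hi a hi S) →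
    + ∣ lo ℤ.+ totalℤ m ℤ.- a i ∣ ℤ.≤ (a i ℤ.- lo) ℤ.+ balanceℤ i m
  -- With w for `without i m`, the two signs of the absolute value leave the slacks 2 (a i - lo - w)
  -- and 2 (totalℤ m - w).
  column-upper m 0≤m m≤ rewrite balance-without i m = ∣∣-lub {lo ℤ.+ totalℤ m ℤ.- a i}
    (≤-by _ (double-nonneg (ℤ.i≤j⇒0≤j-i w≤)) (l₁ (a i) lo (totalℤ m) (without i m)))
    (≤-by _ (double-nonneg (ℤ.i≤j⇒0≤j-i (without≤total i 0≤m))) (l₂ (a i) lo (totalℤ m) (without i m)))
    where
    -- Completely filled, the pieces to the left of a i have total length a i - lo.
    w≤ : without i m ℤ.≤ a i ℤ.- lo
    w≤ = subst (without i m ℤ.≤_)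
      (trans (without-piece a hi i lo≤hi)
        (cong (ℤ._- lo) (trans (cong (clamp lo hi) (ℤ.i≥j⇒i⊓j≡j a≤hi)) (clamp-inside lo≤a a≤hi))))
      (without-mono i m≤)
    l₁ : ∀ a lo t w → (a ℤ.- lo) ℤ.+ (t ℤ.- (w ℤ.+ w)) ≡
      (lo ℤ.+ t ℤ.- a) ℤ.+ (((a ℤ.- lo) ℤ.- w) ℤ.+ ((a ℤ.- lo) ℤ.- w))
    l₁ = solve-∀
    l₂ : ∀ a lo t w → (a ℤ.- lo) ℤ.+ (t ℤ.- (w ℤ.+ w)) ≡
      ℤ.- (lo ℤ.+ t ℤ.- a) ℤ.+ ((t ℤ.- w) ℤ.+ (t ℤ.- w))
    l₂ = solve-∀

-- Sums over all columns

prefix : (ℕ → ℤ) → ℕ → ℤ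
prefix f zero    = 0ℤ
prefix f (suc j) = prefix f j ℤ.+ f j

prefix-cong : ∀ {f g : ℕ → ℤ} → (∀ j → f j ≡ g j) → ∀ n → prefix f n ≡ prefix g n
prefix-cong f≗g zero    = refl
prefix-cong f≗g (suc n) = cong₂ ℤ._+_ (prefix-cong f≗g n) (f≗g n)

prefix-mono : ∀ {f g : ℕ → ℤ} → (∀ j → f j ℤ.≤ g j) → ∀ n → prefix f n ℤ.≤ prefix g n
prefix-mono f≤g zero    = ℤ.≤-refl
prefix-mono f≤g (suc n) = ℤ.+-mono-≤ (prefix-mono f≤g n) (f≤g n)

prefix-nonneg : ∀ {f : ℕ → ℤ} → (∀ j → 0ℤ ℤ.≤ f j) → ∀ n → 0ℤ ℤ.≤ prefix f n
prefix-nonneg 0≤f zero    = ℤ.≤-refl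
prefix-nonneg 0≤f (suc n) = ℤ.+-mono-≤ (prefix-nonneg 0≤f n) (0≤f n)

prefix-+ : ∀ (f g : ℕ → ℤ) n → prefix (λ j → f j ℤ.+ g j) n ≡ prefix f n ℤ.+ prefix g n
prefix-+ f g zero    = refl
prefix-+ f g (suc n) rewrite prefix-+ f g n = lemma (prefix f n) (prefix g n) (f n) (g n)
  where
  lemma : ∀ a b c d → a ℤ.+ b ℤ.+ (c ℤ.+ d) ≡ a ℤ.+ c ℤ.+ (b ℤ.+ d)
  lemma = solve-∀

prefix-- : ∀ (f g : ℕ → ℤ) n → prefix (λ j → f j ℤ.- g j) n ≡ prefix f n ℤ.- prefix g n
prefix-- f g zero    = refl
prefix-- f g (suc n) rewrite prefix-- f g n = lemma (prefix f n) (prefix g n) (f n) (g n)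
  where
  lemma : ∀ a b c d → a ℤ.- b ℤ.+ (c ℤ.- d) ≡ a ℤ.+ c ℤ.- (b ℤ.+ d)
  lemma = solve-∀

prefix-head : ∀ f n → prefix f (suc n) ≡ f 0 ℤ.+ prefix (f ∘ suc) n
prefix-head f zero    = trans (ℤ.+-identityˡ (f 0)) (sym (ℤ.+-identityʳ (f 0)))
prefix-head f (suc n) = trans (cong (ℤ._+ f (suc n)) (prefix-head f n)) (ℤ.+-assoc (f 0) _ _)

sequences : Additive (ℕ → ℤ)
sequences = record { _⊞_ = λ f g j → f j ℤ.+ g j ; _⊟_ = λ f g j → f j ℤ.- g j }

-- Interchange of summations: evaluation at j and `prefix` up to n are both additive maps from
-- `sequences` to `integers`.
prefix-balance : ∀ i (f : ℕ → Type k → ℤ) n →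
  prefix (λ j → balanceℤ i (f j)) n ≡ balanceℤ i (λ S → prefix (λ j → f j S) n)
prefix-balance i f n = trans
  (prefix-cong (λ j → sym (balance-hom sequences integers (λ g → g j)
     (λ _ _ → refl) (λ _ _ → refl) i (λ S j → f j S) (f j) (λ _ → refl))) n)
  (balance-hom sequences integers (λ g → prefix g n)
    (λ g h → prefix-+ g h n) (λ g h → prefix-- g h n) i (λ S j → f j S) _ (λ _ → refl))

cells-inside : ∀ (v : Sequence n) j → cells v (toℕ j) ≡ v j
cells-inside {n} v j with toℕ j ℕ.<? n
... | yes j<n = cong v (Fin.fromℕ<-toℕ j j<n)
... | no  j≮n = contradiction (Fin.toℕ<n j) j≮n

foldr-prefix : ∀ (f : ℕ → ℤ) n (g : Fin n → ℕ) → (∀ i → f (toℕ i) ≡ + g i) →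
               + foldr ℕ._+_ 0 g ≡ prefix f n
foldr-prefix f zero    g f≗g = refl
foldr-prefix f (suc n) g f≗g = trans (ℤ.pos-+ (g zero) _)
  (trans (cong₂ ℤ._+_ (sym (f≗g zero)) (foldr-prefix (f ∘ suc) n (g ∘ suc) (f≗g ∘ suc)))
    (sym (prefix-head f n)))

dist-prefix : ∀ {x y : Sequence n} (f g : ℕ → ℤ) → (∀ j → f (toℕ j) ≡ x j) → (∀ j → g (toℕ j) ≡ y j) →
              + dist x y ≡ prefix (λ j → + ∣ f j ℤ.- g j ∣) n
dist-prefix {x = x} {y} f g f≗x g≗y = foldr-prefix (λ j → + ∣ f j ℤ.- g j ∣) _ (λ j → ∣ x j ℤ.- y j ∣)
  (λ j → cong₂ (λ u v → + ∣ u ℤ.- v ∣) (f≗x j) (g≗y j))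

-- Including 0 covers k = 0.
lowest highest : (Fin k → ℤ) → ℤ
lowest  = foldr ℤ._⊓_ 0ℤ
highest = foldr ℤ._⊔_ 0ℤ

lowest≤ : ∀ (a : Fin k → ℤ) i → lowest a ℤ.≤ a i
lowest≤ a zero    = ℤ.i⊓j≤i (a zero) _
lowest≤ a (suc i) = ℤ.≤-trans (ℤ.i⊓j≤j (a zero) _) (lowest≤ (a ∘ suc) i)

≤highest : ∀ (a : Fin k → ℤ) i → a i ℤ.≤ highest a
≤highest a zero    = ℤ.i≤i⊔j (a zero) _
≤highest a (suc i) = ℤ.≤-trans (≤highest (a ∘ suc) i) (ℤ.i≤j⊔i (a zero) _)

lowest≤0 : ∀ (a : Fin k → ℤ) → lowest a ℤ.≤ 0ℤ
lowest≤0 {zero}  a = ℤ.≤-refl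
lowest≤0 {suc k} a = ℤ.≤-trans (ℤ.i⊓j≤j (a zero) _) (lowest≤0 (a ∘ suc))

0≤highest : ∀ (a : Fin k → ℤ) → 0ℤ ℤ.≤ highest a
0≤highest {zero}  a = ℤ.≤-refl
0≤highest {suc k} a = ℤ.≤-trans (0≤highest (a ∘ suc)) (ℤ.i≤j⊔i (a zero) _)

lowest≤highest : ∀ (a : Fin k → ℤ) → lowest a ℤ.≤ highest a
lowest≤highest a = ℤ.≤-trans (lowest≤0 a) (0≤highest a)

gaps : (Fin k → ℤ) → ℤ → Type k → ℤ
gaps a = piece (lowest a) (highest a) a

widths : (Fin k → ℤ) → Type k → ℤ
widths a = gaps a (highest a)

-- The largest estimated distance, with the same default 0 as `maxDist`.
objective : (Fin k → ℤ) → (Type k → ℤ) → ℤ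
objective d m = foldr ℤ._⊔_ 0ℤ (λ i → d i ℤ.+ balanceℤ i m)

≤objective : ∀ (d : Fin k → ℤ) m i → d i ℤ.+ balanceℤ i m ℤ.≤ objective d m
≤objective d m = ≤highest (λ i → d i ℤ.+ balanceℤ i m)

highest-lub : ∀ (a : Fin k → ℤ) {z} → 0ℤ ℤ.≤ z → (∀ i → a i ℤ.≤ z) → highest a ℤ.≤ z
highest-lub {zero}  a 0≤z a≤z = 0≤z
highest-lub {suc k} a 0≤z a≤z = ℤ.⊔-lub (a≤z zero) (highest-lub (a ∘ suc) 0≤z (a≤z ∘ suc))

-- Greedy distribution

module _ (a : ℕ → Fin k → ℤ) where

  -- The distance from the i-th sequence to the starting point, the sequence of the values `lowest`.
  offset : ℕ → Fin k → ℤ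
  offset n i = prefix (λ j → a j i ℤ.- lowest (a j)) n

  capacity : ℕ → Type k → ℤ
  capacity n S = prefix (λ j → widths (a j) S) n

  amount : (ℕ → ℤ) → ℕ → Type k → ℤ
  amount y n S = prefix (λ j → gaps (a j) (y j) S) n

  amount-nonneg : ∀ y n S → 0ℤ ℤ.≤ amount y n S
  amount-nonneg y n S = prefix-nonneg (λ j → piece-nonneg (a j) (y j) (lowest≤highest (a j)) S) n

  amount≤capacity : ∀ y n S → amount y n S ℤ.≤ capacity n S
  amount≤capacity y n S =
    prefix-mono (λ j → piece≤full (a j) (y j) (lowest≤highest (a j)) ℤ.≤-refl S) n

  sequence-lower : ∀ y n i →
    offset n i ℤ.+ balanceℤ i (amount y n) ℤ.≤ prefix (λ j → + ∣ y j ℤ.- a j i ∣) n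
  sequence-lower y n i = subst (ℤ._≤ _)
    (trans (prefix-+ _ _ n) (cong (λ u → offset n i ℤ.+ u) (prefix-balance i (λ j → gaps (a j) (y j)) n)))
    (prefix-mono (λ j → column-lower {a = a j} i (lowest≤ (a j) i) (≤highest (a j) i) (y j)) n)

  module _ (m : Type k → ℤ) where

    remaining taken : ℕ → Type k → ℤ
    remaining zero    S = m S
    remaining (suc j) S = remaining j S ℤ.- taken j S
    taken j S = remaining j S ℤ.⊓ widths (a j) S

    consensus : ℕ → ℤ
    consensus j = lowest (a j) ℤ.+ totalℤ (taken j)

    module _ (n : ℕ) (0≤m : ∀ S → 0ℤ ℤ.≤ m S) (m≤ : ∀ S → m S ℤ.≤ capacity n S) where

      widths-nonneg : ∀ j S → 0ℤ ℤ.≤ widths (a j) S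
      widths-nonneg j = piece-nonneg (a j) _ (lowest≤highest (a j))

      remaining-nonneg : ∀ j S → 0ℤ ℤ.≤ remaining j S
      remaining-nonneg zero    S = 0≤m S
      remaining-nonneg (suc j) S = ℤ.i≤j⇒0≤j-i (ℤ.i⊓j≤i (remaining j S) _)

      taken-nonneg : ∀ j S → 0ℤ ℤ.≤ taken j S
      taken-nonneg j S = ℤ.⊓-glb (remaining-nonneg j S) (widths-nonneg j S)

      remaining≤ : ∀ j S → remaining j S ℤ.≤ m S
      remaining≤ zero    S = ℤ.≤-refl
      remaining≤ (suc j) S = ℤ.≤-trans
        (≤-by (taken j S) (taken-nonneg j S) (lemma (remaining j S) (taken j S))) (remaining≤ j S)
        where
        lemma : ∀ r t → r ≡ r ℤ.- t ℤ.+ t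
        lemma = solve-∀

      capacity-mono : ∀ {j} S → j ℕ.≤′ n → capacity j S ℤ.≤ capacity n S
      capacity-mono {j} S = go
        where
        go : ∀ {n} → j ℕ.≤′ n → capacity j S ℤ.≤ capacity n S
        go ℕ.≤′-refl = ℤ.≤-refl
        go (ℕ.≤′-step {n} j≤n) = ℤ.≤-trans (go j≤n) (≤-by _ (widths-nonneg n S) refl)

      -- Greedy invariant: what remains fits into the columns not yet visited. Either everything was
      -- taken and nothing remains, or the full width was taken and moves from `remaining` to
      -- `capacity`.
      remaining-fits : ∀ j S → j ℕ.≤ n → remaining j S ℤ.+ capacity j S ℤ.≤ capacity n S
      remaining-fits zero S _ = subst (ℤ._≤ _) (sym (ℤ.+-identityʳ (m S))) (m≤ S)
      remaining-fits (suc j) S j<n with ℤ.≤-total (remaining j S) (widths (a j) S)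
      ... | inj₁ r≤w rewrite ℤ.i≤j⇒i⊓j≡i r≤w = subst (ℤ._≤ capacity n S)
        (lemma (remaining j S) (capacity (suc j) S)) (capacity-mono S (ℕ.≤⇒≤′ j<n))
        where
        lemma : ∀ r c → c ≡ r ℤ.- r ℤ.+ c
        lemma = solve-∀
      ... | inj₂ w≤r rewrite ℤ.i≥j⇒i⊓j≡j w≤r = subst (ℤ._≤ capacity n S)
        (lemma (remaining j S) (capacity j S) (widths (a j) S)) (remaining-fits j S (ℕ.<⇒≤ j<n))
        where
        lemma : ∀ r c w → r ℤ.+ c ≡ r ℤ.- w ℤ.+ (c ℤ.+ w)
        lemma = solve-∀

      taken-remaining : ∀ j S → prefix (λ i → taken i S) j ℤ.+ remaining j S ≡ m S
      taken-remaining zero    S = ℤ.+-identityˡ (m S)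
      taken-remaining (suc j) S =
        trans (lemma (prefix (λ i → taken i S) j) (taken j S) (remaining j S)) (taken-remaining j S)
        where
        lemma : ∀ p t r → p ℤ.+ t ℤ.+ (r ℤ.- t) ≡ p ℤ.+ r
        lemma = solve-∀

      all-taken : ∀ S → prefix (λ j → taken j S) n ≡ m S
      all-taken S = trans (sym (trans (cong (λ r → prefix (λ j → taken j S) n ℤ.+ r) empty)
        (ℤ.+-identityʳ _))) (taken-remaining n S)
        where
        -- At j = n no columns are left, so the invariant bounds the remainder by 0.
        empty : remaining n S ≡ 0ℤ
        empty = ℤ.≤-antisym (subst (ℤ._≤ 0ℤ) (lemma (remaining n S) (capacity n S))
          (ℤ.i≤j⇒i-j≤0 (remaining-fits n S ℕ.≤-refl))) (remaining-nonneg n S)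
          where
          lemma : ∀ r c → r ℤ.+ c ℤ.- c ≡ r
          lemma = solve-∀

      sequence-upper : ∀ i →
        prefix (λ j → + ∣ consensus j ℤ.- a j i ∣) n ℤ.≤ offset n i ℤ.+ balanceℤ i m
      sequence-upper i = subst (prefix _ n ℤ.≤_)
        (trans (prefix-+ _ _ n) (cong (λ u → offset n i ℤ.+ u)
          (trans (prefix-balance i taken n) (balanceℤ-cong i all-taken))))
        (prefix-mono (λ j → column-upper {a = a j} i (lowest≤ (a j) i) (≤highest (a j) i) (taken j)
          (taken-nonneg j) (λ S → ℤ.i⊓j≤j (remaining j S) _)) n)

-- Terms for the column quantities and the objective.

minᵗ maxᵗ : Tm X → Tm X → Tm X
minᵗ s t = if s ≤ t ∶ s ∶ t
maxᵗ s t = if s ≤ t ∶ t ∶ s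

⟦min⟧ : ∀ (s t : Tm X) ρ → ⟦ minᵗ s t ⟧ ρ ≡ ⟦ s ⟧ ρ ℤ.⊓ ⟦ t ⟧ ρ
⟦min⟧ s t ρ with ⟦ s ⟧ ρ ℤ.≤? ⟦ t ⟧ ρ
... | yes s≤t = sym (ℤ.i≤j⇒i⊓j≡i s≤t)
... | no  s≰t = sym (ℤ.i≥j⇒i⊓j≡j (ℤ.<⇒≤ (ℤ.≰⇒> s≰t)))

⟦max⟧ : ∀ (s t : Tm X) ρ → ⟦ maxᵗ s t ⟧ ρ ≡ ⟦ s ⟧ ρ ℤ.⊔ ⟦ t ⟧ ρ
⟦max⟧ s t ρ with ⟦ s ⟧ ρ ℤ.≤? ⟦ t ⟧ ρ
... | yes s≤t = sym (ℤ.i≤j⇒i⊔j≡j s≤t)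
... | no  s≰t = sym (ℤ.i≥j⇒i⊔j≡i (ℤ.<⇒≤ (ℤ.≰⇒> s≰t)))

clampᵗ : Tm X → Tm X → Tm X → Tm X
clampᵗ lo hi t = maxᵗ lo (minᵗ hi t)

⟦clamp⟧ : ∀ (lo hi t : Tm X) ρ → ⟦ clampᵗ lo hi t ⟧ ρ ≡ clamp (⟦ lo ⟧ ρ) (⟦ hi ⟧ ρ) (⟦ t ⟧ ρ)
⟦clamp⟧ lo hi t ρ = trans (⟦max⟧ lo (minᵗ hi t) ρ) (cong (⟦ lo ⟧ ρ ℤ.⊔_) (⟦min⟧ hi t ρ))

lowestᵗ highestᵗ : (Fin k → Tm X) → Tm X
lowestᵗ  = foldr minᵗ (num 0ℤ)
highestᵗ = foldr maxᵗ (num 0ℤ)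

⟦lowest⟧ : ∀ (a : Fin k → Tm X) ρ → ⟦ lowestᵗ a ⟧ ρ ≡ lowest (λ i → ⟦ a i ⟧ ρ)
⟦lowest⟧ {zero}  a ρ = refl
⟦lowest⟧ {suc k} a ρ = trans
  (⟦min⟧ (a zero) (lowestᵗ (a ∘ suc)) ρ)
  (cong (⟦ a zero ⟧ ρ ℤ.⊓_) (⟦lowest⟧ (a ∘ suc) ρ))

⟦highest⟧ : ∀ (a : Fin k → Tm X) ρ → ⟦ highestᵗ a ⟧ ρ ≡ highest (λ i → ⟦ a i ⟧ ρ)
⟦highest⟧ {zero}  a ρ = refl
⟦highest⟧ {suc k} a ρ = trans
  (⟦max⟧ (a zero) (highestᵗ (a ∘ suc)) ρ)
  (cong (⟦ a zero ⟧ ρ ℤ.⊔_) (⟦highest⟧ (a ∘ suc) ρ))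

pieceᵗ : Tm X → Tm X → (Fin k → Tm X) → Tm X → Type k → Tm X
pieceᵗ lo hi a x []          = clampᵗ lo hi x ∸ᵗ lo
pieceᵗ lo hi a x (false ∷ S) = pieceᵗ lo (clampᵗ lo hi (a zero)) (a ∘ suc) x S
pieceᵗ lo hi a x (true ∷ S)  = pieceᵗ (clampᵗ lo hi (a zero)) hi (a ∘ suc) x S

⟦piece⟧ : ∀ (lo hi : Tm X) (a : Fin k → Tm X) x S ρ →
  ⟦ pieceᵗ lo hi a x S ⟧ ρ ≡ piece (⟦ lo ⟧ ρ) (⟦ hi ⟧ ρ) (λ i → ⟦ a i ⟧ ρ) (⟦ x ⟧ ρ) S
⟦piece⟧ lo hi a x [] ρ = cong (ℤ._- ⟦ lo ⟧ ρ) (⟦clamp⟧ lo hi x ρ)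
⟦piece⟧ lo hi a x (false ∷ S) ρ = trans (⟦piece⟧ lo _ (a ∘ suc) x S ρ)
  (cong (λ p → piece (⟦ lo ⟧ ρ) p (λ i → ⟦ a (suc i) ⟧ ρ) (⟦ x ⟧ ρ) S) (⟦clamp⟧ lo hi (a zero) ρ))
⟦piece⟧ lo hi a x (true ∷ S) ρ = trans (⟦piece⟧ _ hi (a ∘ suc) x S ρ)
  (cong (λ p → piece p (⟦ hi ⟧ ρ) (λ i → ⟦ a (suc i) ⟧ ρ) (⟦ x ⟧ ρ) S) (⟦clamp⟧ lo hi (a zero) ρ))

widthsᵗ : (Fin k → Tm X) → Type k → Tm X
widthsᵗ a = pieceᵗ (lowestᵗ a) (highestᵗ a) a (highestᵗ a)

⟦widths⟧ : ∀ (a : Fin k → Tm X) S ρ → ⟦ widthsᵗ a S ⟧ ρ ≡ widths (λ i → ⟦ a i ⟧ ρ) S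
⟦widths⟧ a S ρ = trans (⟦piece⟧ (lowestᵗ a) (highestᵗ a) a (highestᵗ a) S ρ)
  (cong₂ (λ l h → piece l h (λ i → ⟦ a i ⟧ ρ) h S) (⟦lowest⟧ a ρ) (⟦highest⟧ a ρ))

terms : Additive (Tm X)
terms = record { _⊞_ = _∔_ ; _⊟_ = _∸ᵗ_ }

⟦total⟧ : ∀ (f : Type k → Tm X) ρ → ⟦ total terms f ⟧ ρ ≡ totalℤ (λ S → ⟦ f S ⟧ ρ)
⟦total⟧ f ρ = total-hom terms integers (λ t → ⟦ t ⟧ ρ) (λ _ _ → refl) (λ _ _ → refl) f _ (λ _ → refl)

objectiveᵗ : (Fin k → Tm X) → (Type k → Tm X) → Tm X
objectiveᵗ d m = highestᵗ (λ i → d i ∔ balance terms i m)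

highest-cong : ∀ {a b : Fin k → ℤ} → (∀ i → a i ≡ b i) → highest a ≡ highest b
highest-cong {zero}  a≗b = refl
highest-cong {suc k} a≗b = cong₂ ℤ._⊔_ (a≗b zero) (highest-cong (a≗b ∘ suc))

⟦objective⟧ : ∀ (d : Fin k → Tm X) m ρ →
  ⟦ objectiveᵗ d m ⟧ ρ ≡ objective (λ i → ⟦ d i ⟧ ρ) (λ S → ⟦ m S ⟧ ρ)
⟦objective⟧ d m ρ = trans (⟦highest⟧ (λ i → d i ∔ balance terms i m) ρ)
  (highest-cong (λ i → cong (λ u → ⟦ d i ⟧ ρ ℤ.+ u)
  (balance-hom terms integers (λ t → ⟦ t ⟧ ρ) (λ _ _ → refl) (λ _ _ → refl) i m _ (λ _ → refl))))

objective-cong : ∀ (d : Fin k → ℤ) {m m′} → (∀ S → m S ≡ m′ S) → objective d m ≡ objective d m′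
objective-cong d m≗m′ = highest-cong (λ i → cong (λ u → d i ℤ.+ u) (balanceℤ-cong i m≗m′))

encode : Type k → Fin (2 ℕ.^ k)
encode []          = zero
encode (false ∷ S) = Fin.combine {2} zero (encode S)
encode (true ∷ S)  = Fin.combine {2} (suc zero) (encode S)

decode : Fin (2 ℕ.^ k) → Type k
decode {zero}  _ = []
decode {suc k} p with Fin.remQuot {2} (2 ℕ.^ k) p
... | zero     , q = false ∷ decode q
... | suc zero , q = true ∷ decode q

decode-encode : ∀ (S : Type k) → decode (encode S) ≡ S
decode-encode [] = refl
decode-encode (false ∷ S) rewrite Fin.remQuot-combine {2} zero (encode S) = cong (false ∷_) (decode-encode S)
decode-encode (true ∷ S) rewrite Fin.remQuot-combine {2} (suc zero) (encode S) = cong (true ∷_) (decode-encode S)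

-- The integer program

module _ {X : Set} {k : ℕ} (d : Fin k → Tm X) (c : Type k → Tm X) where

  N = 2 ℕ.^ k

  forms : Additive (Lin X (N ℕ.+ 1))
  forms = record { _⊞_ = λ s t → comb 1ℤ s 1ℤ t ; _⊟_ = λ s t → comb 1ℤ s -1ℤ t }

  choice : Type k → Lin X (N ℕ.+ 1)
  choice S = unknown (encode S ↑ˡ 1)

  -- An upper bound for the objective. It is the last unknown because that is the one
  -- `solve-complete` keeps small.
  bound : Lin X (N ℕ.+ 1)
  bound = unknown (N ↑ʳ zero)

  program : System X (N ℕ.+ 1)
  program =
    nonneg bound ∷
    List.tabulate (λ i → nonneg (forms ._⊟_ (forms ._⊟_ bound (term (d i))) (balance forms i choice)))
    List.++ List.tabulate (λ p → nonneg (choice (decode p)))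
    List.++ List.tabulate (λ p → nonneg (forms ._⊟_ (term (c (decode p))) (choice (decode p))))
    where open Additive

  module _ (ρ : X → ℤ) (xs : Vec ℤ (N ℕ.+ 1)) where
    open Additive

    private
      limit = lookup xs (N ↑ʳ zero)
      used : Type k → ℤ
      used S = lookup xs (encode S ↑ˡ 1)

    ev-⊞ : ∀ s t → ev (forms ._⊞_ s t) xs ρ ≡ ev s xs ρ ℤ.+ ev t xs ρ
    ev-⊞ s t = trans (ev-comb 1ℤ s 1ℤ t xs ρ) (lemma (ev s xs ρ) (ev t xs ρ))
      where
      lemma : ∀ u v → 1ℤ ℤ.* u ℤ.+ 1ℤ ℤ.* v ≡ u ℤ.+ v
      lemma = solve-∀

    ev-⊟ : ∀ s t → ev (forms ._⊟_ s t) xs ρ ≡ ev s xs ρ ℤ.- ev t xs ρ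
    ev-⊟ s t = trans (ev-comb 1ℤ s -1ℤ t xs ρ) (lemma (ev s xs ρ) (ev t xs ρ))
      where
      lemma : ∀ u v → 1ℤ ℤ.* u ℤ.+ -1ℤ ℤ.* v ≡ u ℤ.- v
      lemma = solve-∀

    ev-slack : ∀ i →
      ev (forms ._⊟_ (forms ._⊟_ bound (term (d i))) (balance forms i choice)) xs ρ ≡
      limit ℤ.- (⟦ d i ⟧ ρ ℤ.+ balanceℤ i used)
    ev-slack i = trans (ev-⊟ (forms ._⊟_ bound (term (d i))) (balance forms i choice)) (trans (cong₂ ℤ._-_
      (trans (ev-⊟ bound (term (d i))) (cong₂ ℤ._-_ (ev-unknown (N ↑ʳ zero) xs ρ) (ev-term (d i) xs ρ)))
      (balance-hom forms integers (λ s → ev s xs ρ) ev-⊞ ev-⊟ i choice used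
        (λ S → ev-unknown (encode S ↑ˡ 1) xs ρ))) (lemma limit (⟦ d i ⟧ ρ) (balanceℤ i used)))
      where
      lemma : ∀ limit d b → limit ℤ.- d ℤ.- b ≡ limit ℤ.- (d ℤ.+ b)
      lemma = solve-∀

    ev-room : ∀ S → ev (forms ._⊟_ (term (c S)) (choice S)) xs ρ ≡ ⟦ c S ⟧ ρ ℤ.- used S
    ev-room S = trans (ev-⊟ (term (c S)) (choice S))
      (cong₂ ℤ._-_ (ev-term (c S) xs ρ) (ev-unknown (encode S ↑ˡ 1) xs ρ))

    program-complete : 0ℤ ℤ.≤ limit → (∀ i → ⟦ d i ⟧ ρ ℤ.+ balanceℤ i used ℤ.≤ limit) →
      (∀ S → 0ℤ ℤ.≤ used S) → (∀ S → used S ℤ.≤ ⟦ c S ⟧ ρ) → All (Sat xs ρ) program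
    program-complete 0≤z ≤z 0≤used m≤ =
      subst (0ℤ ℤ.≤_) (sym (ev-unknown (N ↑ʳ zero) xs ρ)) 0≤z ∷
      All.++⁺ (All.tabulate⁺ (λ i → subst (0ℤ ℤ.≤_) (sym (ev-slack i)) (ℤ.i≤j⇒0≤j-i (≤z i))))
      (All.++⁺ (All.tabulate⁺ (λ p → subst (0ℤ ℤ.≤_) (sym (ev-unknown (encode (decode {k} p) ↑ˡ 1) xs ρ))
                                       (0≤used (decode p))))
        (All.tabulate⁺ (λ p → subst (0ℤ ℤ.≤_) (sym (ev-room (decode p))) (ℤ.i≤j⇒0≤j-i (m≤ (decode p))))))

    program-sound : All (Sat xs ρ) program →
      0ℤ ℤ.≤ limit × (∀ i → ⟦ d i ⟧ ρ ℤ.+ balanceℤ i used ℤ.≤ limit) ×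
      (∀ S → 0ℤ ℤ.≤ used S) × (∀ S → used S ℤ.≤ ⟦ c S ⟧ ρ)
    program-sound (0≤z ∷ rest)
      with All.++⁻ (List.tabulate _) rest
    ... | slack , rest′ with All.++⁻ (List.tabulate _) rest′
    ...   | lower , upper =
      subst (0ℤ ℤ.≤_) (ev-unknown (N ↑ʳ zero) xs ρ) 0≤z ,
      (λ i → ℤ.0≤i-j⇒j≤i (subst (0ℤ ℤ.≤_) (ev-slack i) (All.tabulate⁻ slack i))) ,
      (λ S → subst (λ S → 0ℤ ℤ.≤ used S) (decode-encode S)
        (subst (0ℤ ℤ.≤_) (ev-unknown _ xs ρ) (All.tabulate⁻ lower (encode S)))) ,
      (λ S → subst (λ S → used S ℤ.≤ ⟦ c S ⟧ ρ) (decode-encode S)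
        (ℤ.0≤i-j⇒j≤i (subst (0ℤ ℤ.≤_) (ev-room (decode (encode S))) (All.tabulate⁻ upper (encode S)))))

  -- Clamping makes every candidate feasible, so the selection can compare objectives without
  -- testing constraints.
  candidate : Vec (Tm X) (N ℕ.+ 1) → Type k → Tm X
  candidate ts S = clampᵗ (num 0ℤ) (c S) (lookup ts (encode S ↑ˡ 1))

  -- The test is the same for all S, so all components come from a single candidate. The fallback 0
  -- is feasible as capacities are nonnegative.
  select : List (Type k → Tm X) → Type k → Tm X
  select []       S = num 0ℤ
  select (m ∷ ms) S = if objectiveᵗ d m ≤ objectiveᵗ d (select ms) ∶ m S ∶ select ms S

  optimum : Type k → Tm X
  optimum = select (List.map candidate (solve (N ℕ.+ 1) program))

  module _ (ρ : X → ℤ) (0≤c : ∀ S → 0ℤ ℤ.≤ ⟦ c S ⟧ ρ) where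

    Feasible : (Type k → ℤ) → Set
    Feasible m = (∀ S → 0ℤ ℤ.≤ m S) × (∀ S → m S ℤ.≤ ⟦ c S ⟧ ρ)

    value : (Type k → Tm X) → ℤ
    value m = ⟦ objectiveᵗ d m ⟧ ρ

    value-objective : ∀ m → value m ≡ objective (λ i → ⟦ d i ⟧ ρ) (λ S → ⟦ m S ⟧ ρ)
    value-objective m = ⟦objective⟧ d m ρ

    ⟦candidate⟧ : ∀ ts S → ⟦ candidate ts S ⟧ ρ ≡ clamp 0ℤ (⟦ c S ⟧ ρ) (⟦ lookup ts (encode S ↑ˡ 1) ⟧ ρ)
    ⟦candidate⟧ ts S = ⟦clamp⟧ (num 0ℤ) (c S) (lookup ts (encode S ↑ˡ 1)) ρ

    candidate-feasible : ∀ ts → Feasible (λ S → ⟦ candidate ts S ⟧ ρ)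
    candidate-feasible ts =
      (λ S → subst (0ℤ ℤ.≤_) (sym (⟦candidate⟧ ts S)) (lo≤clamp 0ℤ (⟦ c S ⟧ ρ) _)) ,
      (λ S → subst (ℤ._≤ ⟦ c S ⟧ ρ) (sym (⟦candidate⟧ ts S)) (clamp≤hi _ (0≤c S)))

    select-feasible : ∀ {ms} → All (λ m → Feasible (λ S → ⟦ m S ⟧ ρ)) ms →
                      Feasible (λ S → ⟦ select ms S ⟧ ρ)
    select-feasible [] = (λ _ → ℤ.≤-refl) , 0≤c
    select-feasible {m ∷ ms} (f ∷ fs) with value m ℤ.≤? value (select ms)
    ... | yes _ = f
    ... | no  _ = select-feasible fs

    optimum-feasible : Feasible (λ S → ⟦ optimum S ⟧ ρ)
    optimum-feasible = select-feasible {List.map candidate (solve (N ℕ.+ 1) program)}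
      (All.map⁺ (All.universal candidate-feasible _))

    value-cong : ∀ {m m′} → (∀ S → ⟦ m S ⟧ ρ ≡ ⟦ m′ S ⟧ ρ) → value m ≡ value m′
    value-cong {m} {m′} eq = trans (value-objective m)
      (trans (objective-cong (λ i → ⟦ d i ⟧ ρ) eq) (sym (value-objective m′)))

    select-step : ∀ m ms → value (select (m ∷ ms)) ≡ value m ℤ.⊓ value (select ms)
    select-step m ms with value m ℤ.≤? value (select ms) in eq
    ... | yes m≤ = trans (value-cong {select (m ∷ ms)} {m}
        (λ S → cong (λ b → if does b then ⟦ m S ⟧ ρ else ⟦ select ms S ⟧ ρ) eq)) (sym (ℤ.i≤j⇒i⊓j≡i m≤))
    ... | no  m≰ = trans (value-cong {select (m ∷ ms)} {select ms}
        (λ S → cong (λ b → if does b then ⟦ m S ⟧ ρ else ⟦ select ms S ⟧ ρ) eq))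
        (sym (ℤ.i≥j⇒i⊓j≡j (ℤ.<⇒≤ (ℤ.≰⇒> m≰))))

    select-least : ∀ {v} ms → Any (λ m → value m ℤ.≤ v) ms → value (select ms) ℤ.≤ v
    select-least (m ∷ ms) (here m≤) rewrite select-step m ms =
      ℤ.≤-trans (ℤ.i⊓j≤i (value m) _) m≤
    select-least (m ∷ ms) (there any) rewrite select-step m ms =
      ℤ.≤-trans (ℤ.i⊓j≤j (value m) _) (select-least ms any)

    -- The amounts m together with their objective v satisfy `program`, so some candidate solves it
    -- with last unknown at most v, and the constraints bound its objective by that unknown.
    optimum-least : ∀ m → Feasible m → value optimum ℤ.≤ objective (λ i → ⟦ d i ⟧ ρ) m
    optimum-least m (0≤m , m≤) = select-least _ (Any.map⁺ (Any.map good
        (solve-complete ρ program xs nonnegative (program-complete ρ xs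
          (subst (0ℤ ℤ.≤_) (sym lastEntry) (0≤highest (λ i → ⟦ d i ⟧ ρ ℤ.+ balanceℤ i m)))
          (λ i → subst₂ ℤ._≤_ (cong (λ u → ⟦ d i ⟧ ρ ℤ.+ u) (balanceℤ-cong i (sym ∘ entry))) (sym lastEntry)
             (≤objective (λ i → ⟦ d i ⟧ ρ) m i))
          (λ S → subst (0ℤ ℤ.≤_) (sym (entry S)) (0≤m S))
          (λ S → subst (ℤ._≤ ⟦ c S ⟧ ρ) (sym (entry S)) (m≤ S))))))
      where
      v = objective (λ i → ⟦ d i ⟧ ρ) m
      xs : Vec ℤ (N ℕ.+ 1)
      xs = Vec.tabulate (m ∘ decode) Vec.++ (v ∷ [])
      nonnegative : VAll (0ℤ ℤ.≤_) xs
      nonnegative = VAll.++⁺ (VAll.tabulate⁺ (0≤m ∘ decode)) (0≤highest (λ i → ⟦ d i ⟧ ρ ℤ.+ balanceℤ i m) ∷ [])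
      lastEntry : lookup xs (N ↑ʳ zero) ≡ v
      lastEntry = Vec.lookup-++ʳ (Vec.tabulate (m ∘ decode)) (v ∷ []) zero
      entry : ∀ S → lookup xs (encode S ↑ˡ 1) ≡ m S
      entry S = trans (Vec.lookup-++ˡ (Vec.tabulate (m ∘ decode)) (v ∷ []) (encode S))
        (trans (Vec.lookup∘tabulate (m ∘ decode) (encode S)) (cong m (decode-encode S)))
      good : ∀ {ts} → Solution ρ program ts ×
             lookup (⟦ ts ⟧* ρ) (N ↑ʳ zero) ℤ.≤ lookup xs (N ↑ʳ zero) →
             value (candidate ts) ℤ.≤ v
      good {ts} (sol , z≤) with program-sound ρ (⟦ ts ⟧* ρ) sol
      ... | 0≤z , ≤z , 0≤ts , ts≤ = subst (ℤ._≤ v) (sym (trans (value-objective (candidate ts))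
          (objective-cong (λ i → ⟦ d i ⟧ ρ) exact)))
        (highest-lub (λ i → ⟦ d i ⟧ ρ ℤ.+ balanceℤ i _) (0≤highest (λ i → ⟦ d i ⟧ ρ ℤ.+ balanceℤ i m))
          (λ i → ℤ.≤-trans (≤z i) (subst (lookup (⟦ ts ⟧* ρ) (N ↑ʳ zero) ℤ.≤_) lastEntry z≤)))
        where
        exact : ∀ S → ⟦ candidate ts S ⟧ ρ ≡ lookup (⟦ ts ⟧* ρ) (encode S ↑ˡ 1)
        exact S = trans (⟦candidate⟧ ts S)
          (trans (cong (clamp 0ℤ (⟦ c S ⟧ ρ)) (sym (Vec.lookup-map (encode S ↑ˡ 1) (λ t → ⟦ t ⟧ ρ) ts)))
            (clamp-inside (0≤ts S) (ts≤ S)))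

-- If the variables are at most b (1 + B), then no intermediate result exceeds
-- magnitude t b (1 + B).
magnitude : Tm X → ℕ → ℕ
magnitude (var x)             b = b
magnitude (num c)             b = ∣ c ∣
magnitude (s ∔ t)             b = magnitude s b + magnitude t b
magnitude (s ∸ᵗ t)            b = magnitude s b + magnitude t b
magnitude (c · t)             b = ∣ c ∣ + magnitude t b + ∣ c ∣ * magnitude t b
magnitude (t ÷1+ d)           b = magnitude t b + suc d
magnitude (if s ≤ t ∶ u ∶ v) b = magnitude s b + magnitude t b + (magnitude u b + magnitude v b)

-- The quotient times 1 + d is i minus a remainder below 1 + d; this crude bound suffices for a
-- constant factor.
∣/∣≤ : ∀ i d → ∣ i ℤ./ + suc d ∣ ≤ ∣ i ∣ + suc d
∣/∣≤ i d = begin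
  ∣ q ∣                 ≤⟨ ℕ.m≤m*n ∣ q ∣ (suc d) ⟩
  ∣ q ∣ * suc d         ≡⟨ ℤ.abs-* q (+ suc d) ⟨
  ∣ q ℤ.* + suc d ∣     ≡⟨ cong ∣_∣ (lemma (ℤ.a≡a%n+[a/n]*n i (+ suc d))) ⟩
  ∣ i ℤ.- + r ∣         ≤⟨ ℤ.∣i-j∣≤∣i∣+∣j∣ i (+ r) ⟩
  ∣ i ∣ + r             ≤⟨ ℕ.+-monoʳ-≤ ∣ i ∣ (ℕ.<⇒≤ (ℤ.n%d<d i (+ suc d))) ⟩
  ∣ i ∣ + suc d         ∎
  where
  open ℕ.≤-Reasoning
  q = i ℤ./ + suc d
  r = i ℤ.% + suc d
  lemma : i ≡ + r ℤ.+ q ℤ.* + suc d → q ℤ.* + suc d ≡ i ℤ.- + r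
  lemma e = sym (trans (cong (ℤ._- + r) e)
    (trans (cong (ℤ._- + r) (ℤ.+-comm (+ r) (q ℤ.* + suc d)))
      (trans (ℤ.+-assoc (q ℤ.* + suc d) (+ r) (ℤ.- + r))
        (trans (cong (λ u → q ℤ.* + suc d ℤ.+ u) (ℤ.+-inverseʳ (+ r))) (ℤ.+-identityʳ _)))))

-- A record, so that m can be inferred from Fits W B m.
record Fits (W B m : ℕ) : Set where
  constructor fit
  field unfit : m * suc B ≤ W
open Fits

module _ {W B : ℕ} where

  left : ∀ {m n} → Fits W B (m + n) → Fits W B m
  left {m} {n} (fit p) = fit (ℕ.≤-trans (ℕ.*-monoˡ-≤ (suc B) (ℕ.m≤m+n m n)) p)

  right : ∀ {m n} → Fits W B (m + n) → Fits W B n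
  right {m} {n} (fit p) = fit (ℕ.≤-trans (ℕ.*-monoˡ-≤ (suc B) (ℕ.m≤n+m n m)) p)

  Fits-self : ∀ {m} → Fits W B m → m ≤ W
  Fits-self {m} (fit p) = ℕ.≤-trans (ℕ.m≤m*n m (suc B)) p

module _ (ρ : X → ℤ) (b B : ℕ) (ρ≤ : ∀ x → ∣ ρ x ∣ ≤ b * suc B) where

  private
    sum≤ : ∀ {i j m n} → i ≤ m * suc B → j ≤ n * suc B → i + j ≤ (m + n) * suc B
    sum≤ {i} {j} {m} {n} p q = subst (i + j ≤_) (sym (ℕ.*-distribʳ-+ (suc B) m n)) (ℕ.+-mono-≤ p q)

  ⟦⟧-bounded : ∀ t → ∣ ⟦ t ⟧ ρ ∣ ≤ magnitude t b * suc B
  ⟦⟧-bounded (var x) = ρ≤ x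
  ⟦⟧-bounded (num c) = ℕ.m≤m*n ∣ c ∣ (suc B)
  ⟦⟧-bounded (s ∔ t) = ℕ.≤-trans (ℤ.∣i+j∣≤∣i∣+∣j∣ (⟦ s ⟧ ρ) (⟦ t ⟧ ρ))
    (sum≤ {m = magnitude s b} (⟦⟧-bounded s) (⟦⟧-bounded t))
  ⟦⟧-bounded (s ∸ᵗ t) = ℕ.≤-trans (ℤ.∣i-j∣≤∣i∣+∣j∣ (⟦ s ⟧ ρ) (⟦ t ⟧ ρ))
    (sum≤ {m = magnitude s b} (⟦⟧-bounded s) (⟦⟧-bounded t))
  ⟦⟧-bounded (c · t) = begin
    ∣ c ℤ.* ⟦ t ⟧ ρ ∣                ≡⟨ ℤ.abs-* c (⟦ t ⟧ ρ) ⟩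
    ∣ c ∣ * ∣ ⟦ t ⟧ ρ ∣              ≤⟨ ℕ.*-monoʳ-≤ ∣ c ∣ (⟦⟧-bounded t) ⟩
    ∣ c ∣ * (magnitude t b * suc B)  ≡⟨ ℕ.*-assoc ∣ c ∣ (magnitude t b) (suc B) ⟨
    ∣ c ∣ * magnitude t b * suc B    ≤⟨ ℕ.*-monoˡ-≤ (suc B) (ℕ.m≤n+m _ (∣ c ∣ + magnitude t b)) ⟩
    magnitude (c · t) b * suc B      ∎
    where open ℕ.≤-Reasoning
  ⟦⟧-bounded (t ÷1+ d) = ℕ.≤-trans (∣/∣≤ (⟦ t ⟧ ρ) d)
    (sum≤ {m = magnitude t b} (⟦⟧-bounded t) (ℕ.m≤m*n (suc d) (suc B)))
  ⟦⟧-bounded (if s ≤ t ∶ u ∶ v) with ⟦ s ⟧ ρ ℤ.≤? ⟦ t ⟧ ρ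
  ... | yes _ = ℕ.≤-trans (⟦⟧-bounded u) (ℕ.*-monoˡ-≤ (suc B)
    (ℕ.≤-trans (ℕ.m≤m+n (magnitude u b) (magnitude v b)) (ℕ.m≤n+m _ (magnitude s b + magnitude t b))))
  ... | no  _ = ℕ.≤-trans (⟦⟧-bounded v) (ℕ.*-monoˡ-≤ (suc B)
    (ℕ.≤-trans (ℕ.m≤n+m (magnitude v b) (magnitude u b)) (ℕ.m≤n+m _ (magnitude s b + magnitude t b))))

-- Programs and their running times

-- A Hoare triple for total correctness. T is merely an upper bound on the time, so a conditional
-- may be charged for both branches.
record Run (W : ℕ) (s : State) (P : Program) (T : ℕ) (Q : State → Set) : Set where
  constructor run
  field
    {final} : State
    {steps} : ℕ
    exec    : Exec W s P steps final
    fast    : steps ≤ T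
    post    : Q final

module _ {W : ℕ} where

  infixl 1 _then_
  _then_ : ∀ {s P P′ T T′ Q Q′} → Run W s P T Q → (∀ {s′} → Q s′ → Run W s′ P′ T′ Q′) →
           Run W s (P ⨟ P′) (T + T′) Q′
  run e f q then next with next q
  ... | run e′ f′ q′ = run (seq e e′) (ℕ.+-mono-≤ f f′) q′

  mapPost : ∀ {s P T} {Q Q′ : State → Set} → (∀ {s′} → Q s′ → Q′ s′) → Run W s P T Q → Run W s P T Q′
  mapPost f (run e t q) = run e t (f q)

  relax : ∀ {s P T T′ Q} → T ≤ T′ → Run W s P T Q → Run W s P T′ Q
  relax T≤ (run e f q) = run e (ℕ.≤-trans f T≤) q

  ifRun : ∀ {s e₁ e₂ P P′ T T′ Q} u v → _⊢_⇓_ W s e₁ u → _⊢_⇓_ W s e₂ v →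
    (u ℤ.≤ v → Run W s P T Q) → (¬ u ℤ.≤ v → Run W s P′ T′ Q) →
    Run W s (if e₁ ⊑ e₂ then P else P′) (1 + cost e₁ + cost e₂ + (T + T′)) Q
  ifRun {e₁ = e₁} {e₂} {T = T} {T′} u v ev₁ ev₂ y n with u ℤ.≤? v
  ... | yes u≤v = let run e f q = y u≤v in run (if-yes ev₁ ev₂ u≤v e)
    (ℕ.+-monoʳ-≤ (1 + cost e₁ + cost e₂) (ℕ.≤-trans f (ℕ.m≤m+n T T′))) q
  ... | no u≰v = let run e f q = n u≰v in run (if-no ev₁ ev₂ u≰v e)
    (ℕ.+-monoʳ-≤ (1 + cost e₁ + cost e₂) (ℕ.≤-trans f (ℕ.m≤n+m T′ T))) q

↦-same : ∀ f a v → (f [ a ↦ v ]) a ≡ v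
↦-same f a v with a ≡ᵇ a | ℕ.≡⇒≡ᵇ a a refl
... | true | _ = refl

↦-other : ∀ f {a b} v → a ≢ b → (f [ a ↦ v ]) b ≡ f b
↦-other f {a} {b} v a≢b with a ≡ᵇ b | ℕ.≡ᵇ⇒≡ a b
... | true  | eq = contradiction (eq tt) a≢b
... | false | _  = refl

record Frame (r : ℕ) (s s′ : State) : Set where
  constructor frame
  field
    regs : ∀ q → q < r → reg s′ q ≡ reg s q
    mems : mem s′ ≡ mem s
open Frame

Frame-refl : ∀ {r s} → Frame r s s
Frame-refl = frame (λ _ _ → refl) refl

Frame-trans : ∀ {r s s′ s″} → Frame r s s′ → Frame r s′ s″ → Frame r s s″
Frame-trans f g = frame (λ q q<r → trans (regs g q q<r) (regs f q q<r)) (trans (mems g) (mems f))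

Frame-weaken : ∀ {r r′ s s′} → r ≤ r′ → Frame r′ s s′ → Frame r s s′
Frame-weaken r≤ f = frame (λ q q<r → regs f q (ℕ.≤-trans q<r r≤)) (mems f)

Computes : ℕ → ℤ → State → State → Set
Computes r v s s′ = reg s′ r ≡ v × Frame r s s′

after : ∀ {r v s s′ s″} → Frame r s s′ → Computes r v s′ s″ → Computes r v s s″
after f (e , g) = e , Frame-trans f g

assignment : ∀ {W s r e v} → _⊢_⇓_ W s e v → Run W s (r ≔ e) (1 + cost e) (Computes r v s)
assignment {s = s} {r} {v = v} ev = run (assign ev) ℕ.≤-refl
  (↦-same (reg s) r v , frame (λ q q<r → ↦-other (reg s) v (ℕ.<⇒≢ q<r ∘ sym)) refl)

register≡ : ∀ {W s r v} → reg s r ≡ v → _⊢_⇓_ W s reg[ r ] v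
register≡ refl = register

-- Compilation of terms and simultaneous updates.

module Compilation {X : Set} (index : X → ℕ) (R : ℕ) (index<R : ∀ x → index x < R)
                   (from : ℕ → X) (from-index : ∀ x → from (index x) ≡ x) where

  Holds : State → (X → ℤ) → Set
  Holds s ρ = ∀ x → reg s (index x) ≡ ρ x

  Holds-frame : ∀ {r s s′ ρ} → R ≤ r → Frame r s s′ → Holds s ρ → Holds s′ ρ
  Holds-frame R≤r f h x = trans (regs f (index x) (ℕ.≤-trans (index<R x) R≤r)) (h x)

  -- Stack discipline: the value goes to register r and registers above r are scratch, while those
  -- below r hold the variables and the pending operands.
  compile : Tm X → ℕ → Program
  compile (var x)   r = r ≔ reg[ index x ]
  compile (num c)   r = r ≔ lit c
  compile (s ∔ t)   r = compile s r ⨟ compile t (suc r) ⨟ r ≔ reg[ r ] ⊕ reg[ suc r ]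
  compile (s ∸ᵗ t)  r = compile s r ⨟ compile t (suc r) ⨟ r ≔ reg[ r ] ⊖ reg[ suc r ]
  compile (c · t)   r = compile t r ⨟ r ≔ lit c ⊗ reg[ r ]
  compile (t ÷1+ d) r = compile t r ⨟ r ≔ reg[ r ] ⊘ lit (+ suc d)
  compile (if s ≤ t ∶ u ∶ v) r =
    compile s r ⨟ compile t (suc r) ⨟ (if reg[ r ] ⊑ reg[ suc r ] then compile u r else compile v r)

  time : Tm X → ℕ
  time (var x)             = 2
  time (num c)             = 2
  time (s ∔ t)             = time s + (time t + 4)
  time (s ∸ᵗ t)            = time s + (time t + 4)
  time (c · t)             = time t + 4
  time (t ÷1+ d)           = time t + 4
  time (if s ≤ t ∶ u ∶ v) = time s + (time t + (3 + (time u + time v)))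

  module _ (ρ : X → ℤ) (b B W : ℕ) (ρ≤ : ∀ x → ∣ ρ x ∣ ≤ b * suc B) where

    fits : ∀ t → Fits W B (magnitude t b) → ∣ ⟦ t ⟧ ρ ∣ ≤ W
    fits t m = ℕ.≤-trans (⟦⟧-bounded ρ b B ρ≤ t) (unfit m)

    Correct : Tm X → Set
    Correct t = ∀ {s} r → R ≤ r → Holds s ρ → Run W s (compile t r) (time t) (Computes r (⟦ t ⟧ ρ) s)

    operands : ∀ {s₁ P T Q r} s t → Correct s → Correct t → R ≤ r → Holds s₁ ρ →
      (∀ {s₃} → reg s₃ r ≡ ⟦ s ⟧ ρ → reg s₃ (suc r) ≡ ⟦ t ⟧ ρ → Frame r s₁ s₃ → Run W s₃ P T Q) →
      Run W s₁ (compile s r ⨟ compile t (suc r) ⨟ P) (time s + (time t + T)) Q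
    operands {r = r} s t run-s run-t R≤r h next =
      run-s r R≤r h then λ { (e , f) →
      run-t (suc r) (ℕ.m≤n⇒m≤1+n R≤r) (Holds-frame R≤r f h) then λ { (e′ , f′) →
      next (trans (regs f′ r ℕ.≤-refl) e) e′ (Frame-trans f (Frame-weaken (ℕ.n≤1+n r) f′)) } }

    compile-correct : ∀ t → Fits W B (magnitude t b) → Correct t
    compile-correct (var x) m r R≤r h = mapPost (λ { (e , f) → trans e (h x) , f }) (assignment register)
    compile-correct (num c) m r R≤r h = assignment (literal (fits (num c) m))
    compile-correct (s ∔ t) m r R≤r h =
      operands s t (compile-correct s (left m)) (compile-correct t (right {m = magnitude s b} m)) R≤r h
        λ e e′ f → mapPost (after f) (assignment (add (register≡ e) (register≡ e′) (fits (s ∔ t) m)))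
    compile-correct (s ∸ᵗ t) m r R≤r h =
      operands s t (compile-correct s (left m)) (compile-correct t (right {m = magnitude s b} m)) R≤r h
        λ e e′ f → mapPost (after f) (assignment (sub (register≡ e) (register≡ e′) (fits (s ∸ᵗ t) m)))
    -- Beside the product, `magnitude (c · t) b` has the summands `∣ c ∣` and `magnitude t b`, so
    -- literal and operand fit even when the product is small.
    compile-correct (c · t) m r R≤r h =
      compile-correct t (right {m = ∣ c ∣} (left m)) r R≤r h then λ { (e , f) →
      mapPost (after f) (assignment
        (mul (literal (Fits-self (left (left m)))) (register≡ e) (fits (c · t) m))) }
    compile-correct (t ÷1+ d) m r R≤r h =
      compile-correct t (left m) r R≤r h then λ { (e , f) →
      mapPost (after f) (assignment (div (register≡ e)
        (literal (Fits-self (right {m = magnitude t b} m))) (fits (t ÷1+ d) m))) }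
    compile-correct (if s ≤ t ∶ u ∶ v) m r R≤r h =
      operands s t (compile-correct s (left (left m))) (compile-correct t (right {m = magnitude s b} (left m))) R≤r h
        λ e e′ f → mapPost (after f) (ifRun (⟦ s ⟧ ρ) (⟦ t ⟧ ρ) (register≡ e) (register≡ e′)
          (λ s≤t → mapPost (branch (dec-true (⟦ s ⟧ ρ ℤ.≤? ⟦ t ⟧ ρ) s≤t))
            (compile-correct u (left (right {m = magnitude s b + magnitude t b} m)) r R≤r (Holds-frame R≤r f h)))
          (λ s≰t → mapPost (branch (dec-false (⟦ s ⟧ ρ ℤ.≤? ⟦ t ⟧ ρ) s≰t))
            (compile-correct v (right {m = magnitude u b} (right {m = magnitude s b + magnitude t b} m))
              r R≤r (Holds-frame R≤r f h))))
      where
      branch : ∀ {b s₁ s₂} → does (⟦ s ⟧ ρ ℤ.≤? ⟦ t ⟧ ρ) ≡ b →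
        Computes r (if b then ⟦ u ⟧ ρ else ⟦ v ⟧ ρ) s₁ s₂ →
        Computes r (⟦ if s ≤ t ∶ u ∶ v ⟧ ρ) s₁ s₂
      branch refl c = c

  module _ (F : X → Tm X) where

    -- All values are computed before the first one is copied, so the assignment
    -- is simultaneous.
    evaluate copy : ℕ → Program
    evaluate zero    = skip
    evaluate (suc n) = evaluate n ⨟ compile (F (from n)) (R + n)
    copy zero    = skip
    copy (suc n) = copy n ⨟ n ≔ reg[ R + n ]

    update : Program
    update = evaluate R ⨟ copy R

    evaluate-time copy-time : ℕ → ℕ
    evaluate-time zero    = 1
    evaluate-time (suc n) = evaluate-time n + time (F (from n))
    copy-time zero    = 1
    copy-time (suc n) = copy-time n + 2

    update-time : ℕ
    update-time = evaluate-time R + copy-time R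

    magnitudes : ℕ → ℕ → ℕ
    magnitudes zero    b = 0
    magnitudes (suc n) b = magnitudes n b + magnitude (F (from n)) b

    module _ (ρ : X → ℤ) (b B W : ℕ) (ρ≤ : ∀ x → ∣ ρ x ∣ ≤ b * suc B) where

      evaluate-correct : ∀ n {s} → Fits W B (magnitudes n b) → Holds s ρ →
        Run W s (evaluate n) (evaluate-time n)
          (λ s′ → (∀ i → i < n → reg s′ (R + i) ≡ ⟦ F (from i) ⟧ ρ) × Frame R s s′)
      evaluate-correct zero    m h = run skip ℕ.≤-refl ((λ _ ()) , Frame-refl)
      evaluate-correct (suc n) m h =
        evaluate-correct n (left m) h
        then λ { (values , f) →
          mapPost (λ { (e , f′) →
            (λ i i<1+n → case ℕ.m<1+n⇒m<n∨m≡n i<1+n of λ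
              { (inj₁ i<n)  → trans (regs f′ (R + i) (ℕ.+-monoʳ-< R i<n)) (values i i<n)
              ; (inj₂ refl) → e }) ,
            Frame-trans f (Frame-weaken (ℕ.m≤m+n R n) f′) })
          (compile-correct ρ b B W ρ≤ (F (from n))
            (right {m = magnitudes n b} m)
            (R + n) (ℕ.m≤m+n R n) (Holds-frame ℕ.≤-refl f h)) }

      -- The sources R + i lie above all targets, so none is overwritten before it is read.
      copy-correct : ∀ n {s} → n ≤ R → Run W s (copy n) (copy-time n)
        (λ s′ → (∀ i → i < n → reg s′ i ≡ reg s (R + i)) ×
                (∀ q → n ≤ q → reg s′ q ≡ reg s q) × mem s′ ≡ mem s)
      copy-correct zero    n≤R = run skip ℕ.≤-refl ((λ _ ()) , (λ _ _ → refl) , refl)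
      copy-correct (suc n) n<R = copy-correct n (ℕ.<⇒≤ n<R) then λ { {s′} (done , rest , same) →
        run (assign register) ℕ.≤-refl
          ( (λ i i<1+n → case ℕ.m<1+n⇒m<n∨m≡n i<1+n of λ
              { (inj₁ i<n)  → trans (↦-other (reg s′) _ (ℕ.<⇒≢ i<n ∘ sym)) (done i i<n)
              ; (inj₂ refl) → trans (↦-same (reg s′) n _) (rest (R + n) (ℕ.m≤n+m n R)) })
          , (λ q n<q → trans (↦-other (reg s′) _ (ℕ.<⇒≢ n<q)) (rest q (ℕ.<⇒≤ n<q)))
          , same) }

      update-correct : ∀ {s} → Fits W B (magnitudes R b) → Holds s ρ →
        Run W s update update-time (λ s′ → Holds s′ (λ x → ⟦ F x ⟧ ρ) × mem s′ ≡ mem s)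
      update-correct m h = evaluate-correct R m h then λ { (values , f) →
        mapPost (λ { (done , _ , same) →
          (λ x → trans (done (index x) (index<R x)) (trans (values (index x) (index<R x))
            (cong (λ x → ⟦ F x ⟧ ρ) (from-index x)))) ,
          trans same (mems f) })
        (copy-correct R ℕ.≤-refl) }

-- The loop over the columns.

repeat : Program → Program
-- Tests are of the form ≤, so j < ℓ is written j + 1 ≤ ℓ. The last test evaluates ℓ + 1, which is
-- why ℓ < W is required; each test costs 5.
repeat body = while reg[ 2 ] ⊕ lit 1ℤ ⊑ reg[ 1 ] loop body

module _ {W ℓ : ℕ} (ℓ<W : ℓ < W) {body : Program} {T : ℕ} (Inv : ℕ → State → Set)
  (counter : ∀ {j s} → Inv j s → reg s 1 ≡ + ℓ × reg s 2 ≡ + j)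
  (step : ∀ j {s} → j < ℓ → Inv j s → Run W s body T (Inv (suc j))) where

  repeat-correct : ∀ n j {s} → j + n ≡ ℓ → Inv j s → Run W s (repeat body) (n * (5 + T) + 5) (Inv ℓ)
  repeat-correct n j {s} eq inv with counter inv
  repeat-correct zero j {s} eq inv | r₁ , r₂ with refl ← trans (sym (ℕ.+-identityʳ j)) eq =
    run (while-stop (add (register≡ r₂) (literal (ℕ.≤-trans (s≤s z≤n) ℓ<W)) (subst (_≤ W) (ℕ.+-comm 1 ℓ) ℓ<W))
          (register≡ r₁) λ { (+≤+ j+1≤j) → ℕ.<-irrefl refl (subst (_≤ ℓ) (ℕ.+-comm ℓ 1) j+1≤j) })
      ℕ.≤-refl inv
  repeat-correct (suc n) j {s} eq inv | r₁ , r₂ with step j j<ℓ inv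
    where
    j<ℓ : j < ℓ
    j<ℓ = subst (j <_) eq (ℕ.m<m+n j (s≤s z≤n))
  ... | run e f q with repeat-correct n (suc j) (trans (sym (ℕ.+-suc j n)) eq) q
  ...   | run {steps = t} e′ f′ q′ =
    run (while-go (add (register≡ r₂) (literal (ℕ.≤-trans (s≤s z≤n) ℓ<W)) (ℕ.≤-trans j+1≤ℓ (ℕ.<⇒≤ ℓ<W)))
          (register≡ r₁) (+≤+ j+1≤ℓ) e e′)
      (ℕ.≤-trans (s≤s (s≤s (s≤s (s≤s (s≤s (ℕ.+-mono-≤ f f′))))))
        (ℕ.≤-reflexive (sym (ℕ.+-assoc (5 + T) (n * (5 + T)) 5)))) q′
    where
    j+1≤ℓ : j + 1 ≤ ℓ
    j+1≤ℓ = subst (j + 1 ≤_) eq (ℕ.+-monoʳ-≤ j (s≤s z≤n))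

concat-combine : ∀ {k ℓ} (A : Collection k ℓ) i j → concat A (Fin.combine i j) ≡ A i j
concat-combine {ℓ = ℓ} A i j =
  cong (λ { (i , j) → A i j }) (Fin.remQuot-combine {k = ℓ} i j)

cells-concat : ∀ {k ℓ} (A : Collection k ℓ) i {j} → j < ℓ →
               cells (concat A) (toℕ i * ℓ + j) ≡ cells (A i) j
cells-concat {ℓ = ℓ} A i {j} j<ℓ = begin
  cells (concat A) (toℕ i * ℓ + j)               ≡⟨ cong (cells (concat A)) address ⟨
  cells (concat A) (toℕ (Fin.combine i (fromℕ< j<ℓ)))  ≡⟨ cells-inside (concat A) _ ⟩
  concat A (Fin.combine i (fromℕ< j<ℓ))          ≡⟨ concat-combine A i _ ⟩
  A i (fromℕ< j<ℓ)                                ≡⟨ cells-inside (A i) (fromℕ< j<ℓ) ⟨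
  cells (A i) (toℕ (fromℕ< j<ℓ))                  ≡⟨ cong (cells (A i)) (Fin.toℕ-fromℕ< j<ℓ) ⟩
  cells (A i) j                                    ∎
  where
  open ≡-Reasoning
  address : toℕ (Fin.combine i (fromℕ< j<ℓ)) ≡ toℕ i * ℓ + j
  address = trans (Fin.toℕ-combine i (fromℕ< j<ℓ))
    (cong₂ _+_ (ℕ.*-comm ℓ (toℕ i)) (Fin.toℕ-fromℕ< j<ℓ))

-- The machine program for a fixed k.

data Var (k : ℕ) : Set where
  out len pos : Var k
  ent off     : Fin k → Var k
  -- Capacities in the first pass, remaining amounts in the second.
  cap         : Type k → Var k

module Solver (k : ℕ) where

  R : ℕ
  R = 3 + (k + (k + 2 ℕ.^ k))

  index : Var k → ℕ
  index out     = 0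
  index len     = 1
  index pos     = 2
  index (ent i) = 3 + toℕ i
  index (off i) = 3 + (k + toℕ i)
  index (cap S) = 3 + (k + (k + toℕ (encode S)))

  index<R : ∀ x → index x < R
  index<R out     = s≤s z≤n
  index<R len     = s≤s (s≤s z≤n)
  index<R pos     = s≤s (s≤s (s≤s z≤n))
  index<R (ent i) = ℕ.+-monoʳ-< 3 (ℕ.≤-trans (Fin.toℕ<n i) (ℕ.m≤m+n k _))
  index<R (off i) = ℕ.+-monoʳ-< 3 (ℕ.+-monoʳ-< k (ℕ.≤-trans (Fin.toℕ<n i) (ℕ.m≤m+n k _)))
  index<R (cap S) = ℕ.+-monoʳ-< 3 (ℕ.+-monoʳ-< k (ℕ.+-monoʳ-< k (Fin.toℕ<n (encode S))))

  choose : ∀ {n} {A : Set} → (Fin n → A) → (ℕ → A) → ℕ → A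
  choose {n} f g m with m ℕ.<? n
  ... | yes m<n = f (fromℕ< m<n)
  ... | no  _   = g (m ∸ n)

  choose-left : ∀ {n A} (f : Fin n → A) g i → choose f g (toℕ i) ≡ f i
  choose-left {n} f g i with toℕ i ℕ.<? n
  ... | yes i<n = cong f (Fin.fromℕ<-toℕ i i<n)
  ... | no  i≮n = contradiction (Fin.toℕ<n i) i≮n

  choose-right : ∀ {n A} (f : Fin n → A) g m → choose f g (n + m) ≡ g m
  choose-right {n} f g m with n + m ℕ.<? n
  ... | yes lt = contradiction (ℕ.m≤m+n n m) (ℕ.<⇒≱ lt)
  ... | no  _  = cong g (ℕ.m+n∸m≡n n m)

  -- Lets `update` run through the variables by counting registers; `out` is a filler beyond R.
  from : ℕ → Var k
  from 0 = out
  from 1 = len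
  from 2 = pos
  from (suc (suc (suc n))) = choose ent (choose off (choose {2 ℕ.^ k} (cap ∘ decode) (λ _ → out))) n

  from-index : ∀ x → from (index x) ≡ x
  from-index out     = refl
  from-index len     = refl
  from-index pos     = refl
  from-index (ent i) = choose-left ent _ i
  from-index (off i) = trans (choose-right ent _ (toℕ i)) (choose-left off _ i)
  from-index (cap S) = trans (choose-right ent _ (k + toℕ (encode S)))
    (trans (choose-right off _ (toℕ (encode S)))
      (trans (choose-left {2 ℕ.^ k} (cap ∘ decode) _ (encode S)) (cong cap (decode-encode S))))

  open Compilation index R index<R from from-index

  env : ℤ → ℕ → ℕ → (Fin k → ℤ) → (Fin k → ℤ) → (Type k → ℤ) → Var k → ℤ
  env o ℓ j v d c out     = o
  env o ℓ j v d c len     = + ℓ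
  env o ℓ j v d c pos     = + j
  env o ℓ j v d c (ent i) = v i
  env o ℓ j v d c (off i) = d i
  env o ℓ j v d c (cap S) = c S

  load : ℕ → Program
  load zero    = skip
  load (suc n) = load n ⨟ 3 + n ≔ mem[ lit (+ n) ⊗ reg[ 1 ] ⊕ reg[ 2 ] ]

  load-time : ℕ → ℕ
  load-time zero    = 1
  load-time (suc n) = load-time n + 7

  module _ {W ℓ j : ℕ} (ℓ<W : suc k * suc ℓ ≤ W) (j<ℓ : j < ℓ) where

    load-correct : ∀ n {s} → n ≤ k → reg s 1 ≡ + ℓ → reg s 2 ≡ + j →
      Run W s (load n) (load-time n) (λ s′ →
        (∀ i → i < n → reg s′ (3 + i) ≡ mem s (i * ℓ + j)) ×
        (∀ q → q < 3 ⊎ 3 + n ≤ q → reg s′ q ≡ reg s q) × mem s′ ≡ mem s)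
    load-correct zero    n≤k r₁ r₂ = run skip ℕ.≤-refl ((λ _ ()) , (λ _ _ → refl) , refl)
    load-correct (suc n) {s} n<k r₁ r₂ = load-correct n (ℕ.<⇒≤ n<k) r₁ r₂ then λ { {s′} (loaded , rest , same) →
      run (assign (memory (subst (_⊢_⇓_ W s′ _) (cong (ℤ._+ + j) (sym (ℤ.pos-* n ℓ)))
            (add (mul (literal n≤W) (register≡ (trans (rest 1 (inj₁ (s≤s (s≤s z≤n)))) r₁)) nℓ≤W)
                 (register≡ (trans (rest 2 (inj₁ (s≤s (s≤s (s≤s z≤n))))) r₂))
                 (subst (λ z → ∣ z ℤ.+ + j ∣ ≤ W) (ℤ.pos-* n ℓ) address≤W)))))
        ℕ.≤-refl
        ( (λ i i<1+n → case ℕ.m<1+n⇒m<n∨m≡n i<1+n of λ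
            { (inj₁ i<n)  → trans (↦-other (reg s′) _ (ℕ.<⇒≢ (ℕ.+-monoʳ-< 3 i<n) ∘ sym)) (loaded i i<n)
            ; (inj₂ refl) → trans (↦-same (reg s′) (3 + n) _) (cong (λ f → f (n * ℓ + j)) same) })
        , (λ { q (inj₁ q<3) → trans (↦-other (reg s′) _ (ℕ.<⇒≢ (ℕ.≤-trans q<3 (ℕ.m≤m+n 3 n)) ∘ sym)) (rest q (inj₁ q<3))
             ; q (inj₂ n<q) → trans (↦-other (reg s′) _ (ℕ.<⇒≢ (subst (_≤ q) (ℕ.+-suc 3 n) n<q)))
                                    (rest q (inj₂ (ℕ.≤-trans (ℕ.+-monoʳ-≤ 3 (ℕ.n≤1+n n)) n<q))) })
        , same) }
      where
      address≤W : n * ℓ + j ≤ W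
      address≤W = begin
        n * ℓ + j         ≤⟨ ℕ.+-monoʳ-≤ (n * ℓ) (ℕ.<⇒≤ j<ℓ) ⟩
        n * ℓ + ℓ         ≡⟨ ℕ.+-comm (n * ℓ) ℓ ⟩
        suc n * ℓ         ≤⟨ ℕ.*-mono-≤ (ℕ.m≤n⇒m≤1+n n<k) (ℕ.n≤1+n ℓ) ⟩
        suc k * suc ℓ     ≤⟨ ℓ<W ⟩
        W                 ∎
        where open ℕ.≤-Reasoning
      n≤W : n ≤ W
      n≤W = ℕ.≤-trans (ℕ.m≤n⇒m≤1+n (ℕ.<⇒≤ n<k)) (ℕ.≤-trans (ℕ.m≤m*n (suc k) (suc ℓ)) ℓ<W)
      nℓ≤W : ∣ + n ℤ.* + ℓ ∣ ≤ W
      nℓ≤W = subst (λ z → ∣ z ∣ ≤ W) (ℤ.pos-* n ℓ) (ℕ.≤-trans (ℕ.m≤m+n (n * ℓ) j) address≤W)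

    load-column : ∀ {s o v w d c} → Holds s (env o ℓ j v d c) →
      (∀ i → mem s (toℕ i * ℓ + j) ≡ w i) →
      Run W s (load k) (load-time k) (λ s′ → Holds s′ (env o ℓ j w d c) × mem s′ ≡ mem s)
    load-column {s} {o} {v} {w} {d} {c} h column = mapPost
      (λ {s′} (loaded , rest , same) → holds {s′} loaded rest , same)
      (load-correct k ℕ.≤-refl (h len) (h pos))
      where
      holds : ∀ {s′} → (∀ i → i < k → reg s′ (3 + i) ≡ mem s (i * ℓ + j)) →
        (∀ q → q < 3 ⊎ 3 + k ≤ q → reg s′ q ≡ reg s q) → Holds s′ (env o ℓ j w d c)
      holds loaded rest out     = trans (rest 0 (inj₁ (s≤s z≤n))) (h out)
      holds loaded rest len     = trans (rest 1 (inj₁ (s≤s (s≤s z≤n)))) (h len)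
      holds loaded rest pos     = trans (rest 2 (inj₁ (s≤s (s≤s (s≤s z≤n))))) (h pos)
      holds loaded rest (ent i) = trans (loaded (toℕ i) (Fin.toℕ<n i)) (column i)
      holds loaded rest (off i) = trans (rest _ (inj₂ (ℕ.+-monoʳ-≤ 3 (ℕ.m≤m+n k _)))) (h (off i))
      holds loaded rest (cap S) = trans (rest _ (inj₂ (ℕ.+-monoʳ-≤ 3 (ℕ.m≤m+n k _)))) (h (cap S))

  entries offsets : Fin k → Tm (Var k)
  entries i = var (ent i)
  offsets i = var (off i)

  capacities takenᵗ : Type k → Tm (Var k)
  capacities S = var (cap S)
  takenᵗ S = minᵗ (capacities S) (widthsᵗ entries S)

  consensusᵗ : Tm (Var k)
  consensusᵗ = lowestᵗ entries ∔ total terms takenᵗ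

  accumulate optimise distribute : Var k → Tm (Var k)
  accumulate pos     = var pos ∔ num 1ℤ
  accumulate (off i) = offsets i ∔ (entries i ∸ᵗ lowestᵗ entries)
  accumulate (cap S) = capacities S ∔ widthsᵗ entries S
  accumulate x       = var x
  optimise out     = objectiveᵗ offsets (optimum offsets capacities)
  optimise pos     = num 0ℤ
  optimise (cap S) = optimum offsets capacities S
  optimise x       = var x
  distribute pos     = var pos ∔ num 1ℤ
  distribute (cap S) = capacities S ∸ᵗ takenᵗ S
  distribute x       = var x

  -- Cell j is overwritten only after column j has been read.
  scan emit solver : Program
  scan = load k ⨟ update accumulate
  emit = load k ⨟ compile consensusᵗ R ⨟ mem[ reg[ 2 ] ]≔ reg[ R ] ⨟ update distribute
  solver = repeat scan ⨟ update optimise ⨟ repeat emit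

-- Bounds on magnitudes and on `maxDist`.

∣cells∣≤ : ∀ {n M} (v : Sequence n) → (∀ i → ∣ v i ∣ ≤ M) → ∀ j → ∣ cells v j ∣ ≤ M
∣cells∣≤ {n} v v≤ j with j ℕ.<? n
... | yes j<n = v≤ (fromℕ< j<n)
... | no  _   = z≤n

∣∣≤-nonneg : ∀ {x n} → 0ℤ ℤ.≤ x → x ℤ.≤ + n → ∣ x ∣ ≤ n
∣∣≤-nonneg (+≤+ _) (+≤+ x≤n) = x≤n

≤-magnitude : ∀ {x M} → ∣ x ∣ ≤ M → x ℤ.≤ + M
≤-magnitude {x} x≤M = ℤ.≤-trans (x≤∣x∣ x) (+≤+ x≤M)

-magnitude≤ : ∀ {x M} → ∣ x ∣ ≤ M → ℤ.- + M ℤ.≤ x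
-magnitude≤ {x} {M} x≤M = subst (ℤ.- + M ℤ.≤_) (ℤ.neg-involutive x)
  (ℤ.neg-mono-≤ (ℤ.≤-trans (-x≤∣x∣ x) (+≤+ x≤M)))

module _ {k M : ℕ} (a : Fin k → ℤ) (a≤ : ∀ i → ∣ a i ∣ ≤ M) where

  -M≤lowest : ℤ.- + M ℤ.≤ lowest a
  -M≤lowest = go a (λ i → -magnitude≤ (a≤ i))
    where
    go : ∀ {k} (a : Fin k → ℤ) → (∀ i → ℤ.- + M ℤ.≤ a i) → ℤ.- + M ℤ.≤ lowest a
    go {zero}  a p = ℤ.neg-≤-pos
    go {suc k} a p = ℤ.⊓-glb (p zero) (go (a ∘ suc) (p ∘ suc))

  highest≤M : highest a ℤ.≤ + M
  highest≤M = highest-lub a (+≤+ z≤n) (λ i → ≤-magnitude (a≤ i))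

  span≤ : ∀ {x} → x ℤ.≤ + M → x ℤ.- lowest a ℤ.≤ + (M + M)
  span≤ x≤M = ℤ.≤-trans (ℤ.+-mono-≤ x≤M (ℤ.neg-mono-≤ -M≤lowest))
    (ℤ.≤-reflexive (trans (cong (λ u → + M ℤ.+ u) (ℤ.neg-involutive (+ M))) (sym (ℤ.pos-+ M M))))

  depth≤ : ∀ i → a i ℤ.- lowest a ℤ.≤ + (M + M)
  depth≤ i = span≤ {a i} (≤-magnitude (a≤ i))

  widths≤ : ∀ S → widths a S ℤ.≤ + (M + M)
  widths≤ S = ℤ.≤-trans (piece≤ a _ (lowest≤highest a) S) (span≤ highest≤M)

prefix≤ : ∀ {f : ℕ → ℤ} {c} → (∀ j → f j ℤ.≤ + c) → ∀ n → prefix f n ℤ.≤ + (n * c)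
prefix≤ f≤ zero    = ℤ.≤-refl
prefix≤ {c = c} f≤ (suc n) = ℤ.≤-trans (ℤ.+-mono-≤ (prefix≤ f≤ n) (f≤ n))
  (ℤ.≤-reflexive (trans (sym (ℤ.pos-+ (n * c) c)) (cong +_ (ℕ.+-comm (n * c) c))))

lub≤maxDist : ∀ {k ℓ} (A : Collection k ℓ) x i → dist x (A i) ≤ maxDist A x
lub≤maxDist A x zero    = ℕ.m≤m⊔n _ _
lub≤maxDist A x (suc i) = ℕ.≤-trans (lub≤maxDist (A ∘ suc) x i) (ℕ.m≤n⊔m (dist x (A zero)) _)

maxDist-lub : ∀ {k ℓ} (A : Collection k ℓ) x {v} → (∀ i → dist x (A i) ≤ v) → maxDist A x ≤ v
maxDist-lub {zero}  A x p = z≤n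
maxDist-lub {suc k} A x p = ℕ.⊔-lub (p zero) (maxDist-lub (A ∘ suc) x (p ∘ suc))

Solved : ∀ {k ℓ} → Collection k ℓ → State → Set
Solved {ℓ = ℓ} A s = ∃[ opt ] outputValue s ≡ + opt × IsOPT A opt × IsConsensus A (outputSequence ℓ s)

-- Correctness of the two passes.

module _ (k : ℕ) where

  open Solver k
  open Compilation index R index<R from from-index

  -- Registers stay below sizeᵢ (1 + ℓ) (1 + M) in the i-th pass.
  size₁ size₂ wordsize speed : ℕ
  size₁ = k + 2
  size₂ = magnitude (optimise out) size₁ + size₁
  wordsize = suc k + (magnitudes accumulate R size₁ +
    (magnitudes optimise R size₁ +
    (magnitude consensusᵗ size₂ + magnitudes distribute R size₂)))

  scan-time emit-time : ℕ
  scan-time = load-time k + update-time accumulate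
  emit-time = load-time k + (time consensusᵗ + (3 + update-time distribute))
  speed = (5 + scan-time) + (update-time optimise + (5 + emit-time))

  module _ {ℓ M W : ℕ} (A : Collection k ℓ) (A≤M : BoundedBy M A)
           (W≥ : wordsize * (suc ℓ * suc M) ≤ W) where

    -- Chosen so that `suc B` computes to `suc ℓ * suc M`.
    B : ℕ
    B = M + ℓ * suc M

    word : Fits W B wordsize
    word = fit W≥

    a : ℕ → Fin k → ℤ
    a j i = cells (A i) j

    a≤ : ∀ j i → ∣ a j i ∣ ≤ M
    a≤ j i = ∣cells∣≤ (A i) (A≤M i) j

    M≤ : M ≤ suc B
    M≤ = ℕ.m≤n⇒m≤1+n (ℕ.m≤m+n M _)

    ℓ≤ : ℓ ≤ suc B
    ℓ≤ = ℕ.≤-trans (ℕ.n≤1+n ℓ) (ℕ.m≤m*n (suc ℓ) (suc M))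

    span : ∀ {j} → j ≤ ℓ → j * (M + M) ≤ 2 * suc B
    span {j} j≤ℓ = begin
      j * (M + M)              ≡⟨ ℕ.*-distribˡ-+ j M M ⟩
      j * M + j * M            ≤⟨ ℕ.+-mono-≤ jM≤ (ℕ.≤-trans jM≤ (ℕ.m≤m+n (suc B) 0)) ⟩
      2 * suc B                ∎
      where
      open ℕ.≤-Reasoning
      jM≤ : j * M ≤ suc B
      jM≤ = ℕ.*-mono-≤ (ℕ.m≤n⇒m≤1+n j≤ℓ) (ℕ.n≤1+n M)

    capacity≤ : ∀ {j} → j ≤ ℓ → ∀ S → capacity a j S ℤ.≤ + (2 * suc B)
    capacity≤ {j} j≤ℓ S = ℤ.≤-trans (prefix≤ (λ j → widths≤ (a j) (a≤ j) S) j) (+≤+ (span j≤ℓ))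

    capacity-nonneg : ∀ j S → 0ℤ ℤ.≤ capacity a j S
    capacity-nonneg j S = prefix-nonneg (λ j → piece-nonneg (a j) _ (lowest≤highest (a j)) S) j

    offset-bounded : ∀ {j} → j ≤ ℓ → ∀ i → ∣ offset a j i ∣ ≤ 2 * suc B
    offset-bounded {j} j≤ℓ i = ∣∣≤-nonneg (prefix-nonneg (λ j → ℤ.i≤j⇒0≤j-i (lowest≤ (a j) i)) j)
      (ℤ.≤-trans (prefix≤ (λ j → depth≤ (a j) (a≤ j) i) j) (+≤+ (span j≤ℓ)))

    -- j is the current column and j′ the number of columns summed in the offsets: they agree in the
    -- first pass, and j′ is ℓ in the second.
    env-bounded : ∀ {o j} b {c : Type k → ℤ} → 2 ≤ b → ∣ o ∣ ≤ b * suc B → ∀ {j′} → j ≤ ℓ → j′ ≤ ℓ →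
      (∀ S → ∣ c S ∣ ≤ 2 * suc B) →
      ∀ {v} → (∀ i → ∣ v i ∣ ≤ M) → ∀ x → ∣ env o ℓ j v (offset a j′) c x ∣ ≤ b * suc B
    env-bounded {o} {j} b {c} 2≤b o≤ {j′} j≤ j′≤ c≤ {v} v≤ = go
      where
      2≤ : ∀ {x} → x ≤ 2 * suc B → x ≤ b * suc B
      2≤ x≤ = ℕ.≤-trans x≤ (ℕ.*-monoˡ-≤ (suc B) 2≤b)
      1≤ : ∀ {x} → x ≤ suc B → x ≤ b * suc B
      1≤ x≤ = 2≤ (ℕ.≤-trans x≤ (ℕ.m≤m+n (suc B) _))
      go : ∀ x → ∣ env o ℓ j v (offset a j′) c x ∣ ≤ b * suc B
      go out     = o≤
      go len     = 1≤ ℓ≤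
      go pos     = 1≤ (ℕ.≤-trans j≤ ℓ≤)
      go (ent i) = 1≤ (ℕ.≤-trans (v≤ i) M≤)
      go (off i) = 2≤ (offset-bounded j′≤ i)
      go (cap S) = 2≤ (c≤ S)

    Bounded : ℕ → (Var k → ℤ) → Set
    Bounded b ρ = ∀ x → ∣ ρ x ∣ ≤ b * suc B

    ρ₁ : ℕ → (Fin k → ℤ) → Var k → ℤ
    ρ₁ j v = env (+ k) ℓ j v (offset a j) (capacity a j)

    -- In `size₁` the summand k is for register 0, which still holds the input k, and 2 is for sums
    -- of at most ℓ differences, each at most 2 M.
    ρ₁-bounded : ∀ {j v} → j ≤ ℓ → (∀ i → ∣ v i ∣ ≤ M) → Bounded size₁ (ρ₁ j v)
    ρ₁-bounded {j} j≤ v≤ = env-bounded size₁ (ℕ.m≤n+m 2 k)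
      (ℕ.≤-trans (ℕ.m≤m+n k 2) (ℕ.m≤m*n size₁ (suc B))) j≤ j≤
      (λ S → ∣∣≤-nonneg (capacity-nonneg j S) (capacity≤ j≤ S)) v≤

    -- Output overwrites cells from the left. Column j occupies addresses i * ℓ + j ≥ j, so it is
    -- intact as long as the cells from j on are.
    Stored : State → ℕ → Set
    Stored s j = ∀ q → j ≤ q → mem s q ≡ cells (concat A) q

    column-stored : ∀ {s j} → j < ℓ → Stored s j → ∀ i → mem s (toℕ i * ℓ + j) ≡ a j i
    column-stored {j = j} j<ℓ stored i =
      trans (stored (toℕ i * ℓ + j) (ℕ.m≤n+m j (toℕ i * ℓ))) (cells-concat A i j<ℓ)

    -- The entry registers hold leftovers v of an earlier column. Their bound is recorded because
    -- `update optimise` runs without a fresh load and needs all registers bounded.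
    Scanned : ℕ → State → Set
    Scanned j s = (∃[ v ] (∀ i → ∣ v i ∣ ≤ M) × Holds s (ρ₁ j v)) × Stored s 0

    accumulate-correct : ∀ j x → ⟦ accumulate x ⟧ (ρ₁ j (a j)) ≡ ρ₁ (suc j) (a j) x
    accumulate-correct j out     = refl
    accumulate-correct j len     = refl
    accumulate-correct j pos     = cong +_ (ℕ.+-comm j 1)
    accumulate-correct j (ent i) = refl
    accumulate-correct j (off i) =
      cong (λ l → offset a j i ℤ.+ (a j i ℤ.- l)) (⟦lowest⟧ entries (ρ₁ j (a j)))
    accumulate-correct j (cap S) =
      cong (λ w → capacity a j S ℤ.+ w) (⟦widths⟧ entries S (ρ₁ j (a j)))

    enough-words : suc k * suc ℓ ≤ W
    enough-words = ℕ.≤-trans (ℕ.*-monoʳ-≤ (suc k) (ℕ.m≤m*n (suc ℓ) (suc M))) (unfit (left {m = suc k} word))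

    ℓ<W : ℓ < W
    ℓ<W = ℕ.≤-trans (ℕ.m≤n*m (suc ℓ) (suc k)) enough-words

    scan-correct : ∀ j {s} → j < ℓ → Scanned j s → Run W s scan scan-time (Scanned (suc j))
    scan-correct j {s} j<ℓ ((v , v≤ , h) , stored) =
      load-column enough-words j<ℓ h (column-stored {s} j<ℓ (λ q _ → stored q z≤n)) then λ { (h′ , same) →
      mapPost (λ { (h″ , same′) →
          (a j , a≤ j , λ x → trans (h″ x) (accumulate-correct j x)) ,
          (λ q z → trans (cong-app (trans same′ same) q) (stored q z)) })
        (update-correct accumulate (ρ₁ j (a j)) size₁ B W
          (ρ₁-bounded (ℕ.<⇒≤ j<ℓ) (a≤ j)) (left (right {m = suc k} word)) h′) }

    initially : Scanned 0 (input A)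
    initially = ((λ _ → 0ℤ) , (λ _ → z≤n) ,
      λ { out → refl ; len → refl ; pos → refl ; (ent i) → refl ; (off i) → refl ; (cap S) → refl }) ,
      (λ _ _ → refl)

    ρ* : (Fin k → ℤ) → Var k → ℤ
    ρ* = ρ₁ ℓ

    module _ (v : Fin k → ℤ) (v≤ : ∀ i → ∣ v i ∣ ≤ M) where

      m : Type k → ℤ
      m S = ⟦ optimum offsets capacities S ⟧ (ρ* v)

      best : ℤ
      best = ⟦ optimise out ⟧ (ρ* v)

      m-feasible : (∀ S → 0ℤ ℤ.≤ m S) × (∀ S → m S ℤ.≤ capacity a ℓ S)
      m-feasible = optimum-feasible offsets capacities (ρ* v) (capacity-nonneg ℓ)

      best-objective : best ≡ objective (offset a ℓ) m
      best-objective = ⟦objective⟧ offsets (optimum offsets capacities) (ρ* v)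

      best-least : ∀ n → (∀ S → 0ℤ ℤ.≤ n S) → (∀ S → n S ℤ.≤ capacity a ℓ S) →
                   best ℤ.≤ objective (offset a ℓ) n
      best-least n 0≤n n≤ = optimum-least offsets capacities (ρ* v) (capacity-nonneg ℓ) n (0≤n , n≤)

      ρ₂ : ℕ → (Fin k → ℤ) → Var k → ℤ
      ρ₂ j w = env best ℓ j w (offset a ℓ) (remaining a m j)

      ρ₂-bounded : ∀ {j w} → j ≤ ℓ → (∀ i → ∣ w i ∣ ≤ M) → Bounded size₂ (ρ₂ j w)
      ρ₂-bounded {j} j≤ w≤ = env-bounded size₂
        (ℕ.≤-trans (ℕ.m≤n+m 2 k) (ℕ.m≤n+m size₁ (magnitude (optimise out) size₁)))
        (ℕ.≤-trans (⟦⟧-bounded (ρ* v) size₁ B (ρ₁-bounded ℕ.≤-refl v≤) (optimise out))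
          (ℕ.*-monoˡ-≤ (suc B) (ℕ.m≤m+n (magnitude (optimise out) size₁) size₁)))
        j≤ ℕ.≤-refl
        (λ S → ∣∣≤-nonneg (remaining-nonneg a m ℓ (proj₁ m-feasible) (proj₂ m-feasible) j S)
          (ℤ.≤-trans (remaining≤ a m ℓ (proj₁ m-feasible) (proj₂ m-feasible) j S)
            (ℤ.≤-trans (proj₂ m-feasible S) (capacity≤ ℕ.≤-refl S))))
        w≤

      Emitted : ℕ → State → Set
      Emitted j s = (∃[ w ] Holds s (ρ₂ j w)) ×
        (∀ q → q < j → mem s q ≡ consensus a m q) × Stored s j

      optimise-correct : ∀ x → ⟦ optimise x ⟧ (ρ* v) ≡ ρ₂ 0 v x
      optimise-correct out     = refl
      optimise-correct len     = refl
      optimise-correct pos     = refl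
      optimise-correct (ent i) = refl
      optimise-correct (off i) = refl
      optimise-correct (cap S) = refl

      optimise-run : ∀ {s} → Holds s (ρ* v) → Stored s 0 →
        Run W s (update optimise) (update-time optimise) (Emitted 0)
      optimise-run h stored = mapPost
        (λ { (h′ , same) → (v , λ x → trans (h′ x) (optimise-correct x)) , (λ _ ()) ,
               λ q z → trans (cong-app same q) (stored q z) })
        (update-correct optimise (ρ* v) size₁ B W (ρ₁-bounded ℕ.≤-refl v≤)
          (left (right {m = magnitudes accumulate R size₁} (right {m = suc k} word))) h)

      rest : Fits W B (magnitude consensusᵗ size₂ + magnitudes distribute R size₂)
      rest = right {m = magnitudes optimise R size₁}
        (right {m = magnitudes accumulate R size₁} (right {m = suc k} word))

      taken-correct : ∀ j S → ⟦ takenᵗ S ⟧ (ρ₂ j (a j)) ≡ taken a m j S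
      taken-correct j S = trans (⟦min⟧ (capacities S) (widthsᵗ entries S) (ρ₂ j (a j)))
        (cong (remaining a m j S ℤ.⊓_) (⟦widths⟧ entries S (ρ₂ j (a j))))

      consensus-correct : ∀ j → ⟦ consensusᵗ ⟧ (ρ₂ j (a j)) ≡ consensus a m j
      consensus-correct j = cong₂ ℤ._+_ (⟦lowest⟧ entries (ρ₂ j (a j)))
        (trans (⟦total⟧ takenᵗ (ρ₂ j (a j))) (totalℤ-cong (taken-correct j)))

      distribute-correct : ∀ j x → ⟦ distribute x ⟧ (ρ₂ j (a j)) ≡ ρ₂ (suc j) (a j) x
      distribute-correct j out     = refl
      distribute-correct j len     = refl
      distribute-correct j pos     = cong +_ (ℕ.+-comm j 1)
      distribute-correct j (ent i) = refl
      distribute-correct j (off i) = refl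
      distribute-correct j (cap S) = cong (λ t → remaining a m j S ℤ.- t) (taken-correct j S)

      emit-correct : ∀ j {s} → j < ℓ → Emitted j s → Run W s emit emit-time (Emitted (suc j))
      emit-correct j {s} j<ℓ ((w , h) , done , stored) =
        load-column enough-words j<ℓ h (column-stored {s} j<ℓ stored) then λ { (h₁ , same₁) →
        compile-correct (ρ₂ j (a j)) size₂ B W (ρ₂-bounded (ℕ.<⇒≤ j<ℓ) (a≤ j)) consensusᵗ (left rest)
          R ℕ.≤-refl h₁ then λ { {s₂} (e , f) →
        store-run (Holds-frame ℕ.≤-refl f h₁) e then λ { (h₂ , written) →
        mapPost (λ { (h₃ , same₃) →
            (a j , λ x → trans (h₃ x) (distribute-correct j x)) ,
            (λ q q<1+j → trans (cong-app (trans same₃ written) q) (case ℕ.m<1+n⇒m<n∨m≡n q<1+j of λ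
              { (inj₁ q<j)  → trans (↦-other (mem s₂) _ (ℕ.<⇒≢ q<j ∘ sym))
                  (trans (cong-app (trans (Frame.mems f) same₁) q) (done q q<j))
              ; (inj₂ refl) → trans (↦-same (mem s₂) j _) (consensus-correct j) })) ,
            (λ q j<q → trans (cong-app (trans same₃ written) q) (trans (↦-other (mem s₂) _ (ℕ.<⇒≢ j<q))
              (trans (cong-app (trans (Frame.mems f) same₁) q) (stored q (ℕ.<⇒≤ j<q))))) })
          (update-correct distribute (ρ₂ j (a j)) size₂ B W (ρ₂-bounded (ℕ.<⇒≤ j<ℓ) (a≤ j))
            (right {m = magnitude consensusᵗ size₂} rest) h₂) } } }
        where
        store-run : ∀ {s u} → Holds s (ρ₂ j (a j)) → reg s R ≡ u →
          Run W s (mem[ reg[ 2 ] ]≔ reg[ R ]) 3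
            (λ s′ → Holds s′ (ρ₂ j (a j)) × mem s′ ≡ mem s [ j ↦ u ])
        store-run h e = run (store (register≡ (h pos)) (register≡ e)) ℕ.≤-refl (h , refl)

      emits-best : ∀ s → Emitted ℓ s → outputValue s ≡ best
      emits-best s ((w , h) , _) = h out

      module _ s (emitted : Emitted ℓ s) where

        x : Sequence ℓ
        x = outputSequence ℓ s

        opt : ℕ
        opt = ∣ best ∣

        +opt : + opt ≡ best
        +opt = ℤ.0≤i⇒+∣i∣≡i (subst (0ℤ ℤ.≤_) (sym best-objective)
          (0≤highest (λ i → offset a ℓ i ℤ.+ balanceℤ i m)))

        -- The amounts used by y are a competitor in the integer program.
        opt-least : ∀ y → opt ≤ maxDist A y
        opt-least y = ℤ.drop‿+≤+ (subst (ℤ._≤ + maxDist A y) (sym +opt)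
          (ℤ.≤-trans (best-least (amount a ŷ ℓ) (amount-nonneg a ŷ ℓ) (amount≤capacity a ŷ ℓ))
            (highest-lub (λ i → offset a ℓ i ℤ.+ balanceℤ i (amount a ŷ ℓ)) (+≤+ z≤n) (λ i →
              ℤ.≤-trans (sequence-lower a ŷ ℓ i)
                (subst (ℤ._≤ + maxDist A y) (dist-prefix ŷ (cells (A i)) (cells-inside y) (cells-inside (A i)))
                  (+≤+ (lub≤maxDist A y i)))))))
          where
          ŷ = cells y

        x≤opt : maxDist A x ≤ opt
        x≤opt = maxDist-lub A x λ i → ℤ.drop‿+≤+ (subst₂ ℤ._≤_
          (sym (dist-prefix (consensus a m) (cells (A i))
            (λ j → sym (proj₁ (proj₂ emitted) (toℕ j) (Fin.toℕ<n j))) (cells-inside (A i))))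
          (sym (trans +opt best-objective))
          (ℤ.≤-trans (sequence-upper a m ℓ (proj₁ m-feasible) (proj₂ m-feasible) i)
            (≤objective (offset a ℓ) m i)))

        x-optimal : maxDist A x ≡ opt
        x-optimal = ℕ.≤-antisym x≤opt (opt-least x)

    solver-correct : Run W (input A) solver (speed * suc ℓ) (Solved A)
    solver-correct = relax total-time (repeat-correct ℓ<W Scanned
        (λ { ((v , _ , h) , _) → h len , h pos }) scan-correct ℓ 0 refl initially
      then λ { ((v , v≤ , h) , stored) → optimise-run v v≤ h stored
      then λ emitted → mapPost (λ {s} → finish v v≤ s)
        (repeat-correct ℓ<W (Emitted v v≤) (λ { ((w , h) , _) → h len , h pos }) (emit-correct v v≤)
          ℓ 0 refl emitted) })
      where
      finish : ∀ v v≤ s → Emitted v v≤ ℓ s → Solved A s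
      finish v v≤ s e = opt v v≤ s e , trans (emits-best v v≤ s e) (sym (+opt v v≤ s e)) ,
        ((x v v≤ s e , x-optimal v v≤ s e) , opt-least v v≤ s e) ,
        ((x v v≤ s e , refl) , λ y → subst (_≤ maxDist A y) (sym (x-optimal v v≤ s e)) (opt-least v v≤ s e y))
      lap : ∀ t → ℓ * (5 + t) + 5 ≤ (5 + t) * suc ℓ
      lap t = begin
        ℓ * (5 + t) + 5        ≤⟨ ℕ.+-monoʳ-≤ (ℓ * (5 + t)) (ℕ.m≤m+n 5 t) ⟩
        ℓ * (5 + t) + (5 + t)  ≡⟨ ℕ.+-comm (ℓ * (5 + t)) (5 + t) ⟩
        suc ℓ * (5 + t)        ≡⟨ ℕ.*-comm (suc ℓ) (5 + t) ⟩
        (5 + t) * suc ℓ        ∎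
        where open ℕ.≤-Reasoning
      u = update-time optimise
      total-time : (ℓ * (5 + scan-time) + 5) + (u + (ℓ * (5 + emit-time) + 5)) ≤ speed * suc ℓ
      total-time = subst ((ℓ * (5 + scan-time) + 5) + (u + (ℓ * (5 + emit-time) + 5)) ≤_)
        (sym (trans (ℕ.*-distribʳ-+ (suc ℓ) (5 + scan-time) (u + (5 + emit-time)))
          (cong (λ z → (5 + scan-time) * suc ℓ + z) (ℕ.*-distribʳ-+ (suc ℓ) u (5 + emit-time)))))
        (ℕ.+-mono-≤ (lap scan-time) (ℕ.+-mono-≤ (ℕ.m≤m*n u (suc ℓ)) (lap emit-time)))

-- Dispatch on the number of sequences.

dispatch : ℕ → Program
dispatch zero    = Solver.solver 0
dispatch (suc n) = if reg[ 0 ] ⊑ lit (+ n) then dispatch n else Solver.solver (suc n)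

wordsizes speeds : ℕ → ℕ
wordsizes zero    = wordsize 0
-- The summand n makes the literal in the test fit into a word.
wordsizes (suc n) = wordsizes n + (n + wordsize (suc n))
speeds zero    = speed 0
speeds (suc n) = 3 + (speeds n + speed (suc n))

-- `solver` is a different program for each k, and k is known only at run time, so a chain of tests
-- on register 0 selects it. When k ≤ suc n and the test k ≤ n fails, k is suc n.
dispatch-correct : ∀ K {k ℓ M W} (A : Collection k ℓ) → k ≤ K → BoundedBy M A →
  Fits W (M + ℓ * suc M) (wordsizes K) → Run W (input A) (dispatch K) (speeds K * suc ℓ) (Solved A)
dispatch-correct zero    A z≤n A≤M (fit w) = solver-correct 0 A A≤M w
dispatch-correct (suc n) {k} {ℓ} A k≤ A≤M w = relax
  (subst (3 + (speeds n * suc ℓ + speed (suc n) * suc ℓ) ≤_)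
    (sym (trans (ℕ.*-distribʳ-+ (suc ℓ) 3 (speeds n + speed (suc n)))
      (cong (λ z → 3 * suc ℓ + z) (ℕ.*-distribʳ-+ (suc ℓ) (speeds n) (speed (suc n))))))
    (ℕ.+-monoˡ-≤ _ (ℕ.m≤m*n 3 (suc ℓ))))
  (ifRun (+ k) (+ n) register (literal (Fits-self (left (right {m = wordsizes n} w))))
    (λ { (+≤+ k≤n) → dispatch-correct n A k≤n A≤M (left w) })
    (λ k≰n → last (ℕ.≤-antisym k≤ (ℕ.≰⇒> (λ k≤n → k≰n (+≤+ k≤n)))) A A≤M))
  where
  last : ∀ {k} → k ≡ suc n → (A : Collection k ℓ) → BoundedBy _ A →
    Run _ (input A) (Solver.solver (suc n)) (speed (suc n) * suc ℓ) (Solved A)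
  last refl A A≤M = solver-correct (suc n) A A≤M (unfit (right {m = n} (right {m = wordsizes n} w)))

consensus-in-linear-time : ∀ K → ∃[ P ] ∃[ c ] ∃[ d ]
    ((k ℓ M : ℕ) (A : Collection k ℓ) → k ≤ K → BoundedBy M A →
    ∃[ s ] ∃[ t ] ∃[ opt ]
    (Exec (d * (suc ℓ * suc M)) (input A) P t s
    × t ≤ c * suc ℓ
    × outputValue s ≡ + opt
    × IsOPT A opt
    × IsConsensus A (outputSequence ℓ s)))
consensus-in-linear-time K = dispatch K , speeds K , wordsizes K , λ k ℓ M A k≤K A≤M →
  case dispatch-correct K A k≤K A≤M (fit ℕ.≤-refl) of λ
    { (run {s} {t} exec fast (opt , value , isOPT , isConsensus)) →
        s , t , opt , exec , fast , value , isOPT , isConsensus }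

mainTheorem1 : ∃[ P ] ∃[ c ] ∃[ d ]
    ((k ℓ M : ℕ) (A : Collection k ℓ) → k ≤ 5 → BoundedBy M A →
    ∃[ s ] ∃[ t ] ∃[ opt ]
    (Exec (d * (suc ℓ * suc M)) (input A) P t s
    × t ≤ c * suc ℓ
    × outputValue s ≡ + opt
    × IsOPT A opt
    × IsConsensus A (outputSequence ℓ s)))
mainTheorem1 = consensus-in-linear-time 5
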